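{- The order type of the set $\{\alpha < \omega_1 \mid \alpha \text{ is a transcendental ordinal}\}$ is $\omega_1$.
   Context: $\oplus$ and $\otimes$ denote Nim-sum and Nim-product of ordinals, defined recursively by $\alpha \oplus \beta = \operatorname{mex}\{\alpha' \oplus \beta, \alpha \oplus \beta' \mid \alpha'<\alpha, \beta'<\beta\}$ and $\alpha \otimes \beta = \operatorname{mex}\{(\alpha' \otimes \beta) \oplus (\alpha \otimes \beta') \oplus (\alpha' \otimes \beta') \mid \alpha'<\alpha, \beta'<\beta\}$, where $\operatorname{mex}(S)$ is the least ordinal not in $S$. With these operations the class of ordinals is a Field of characteristic 2, denoted $\mathrm{On}_2$. An ordinal is identified with the set of smaller ordinals. An ordinal is called transcendental if it is an algebraically closed subfield of $\mathrm{On}_2$. $\omega_1$ is the first uncountable ordinal. -}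

module Defs where

open import Algebra.Bundles.Raw using (RawSemiring)
import Algebra.Definitions.RawSemiring as RawSemiringDefs
open import Axiom.ExcludedMiddle using (ExcludedMiddle)
open import Data.Empty using (⊥)
open import Data.Fin.Base using (toℕ; fromℕ)
open import Data.Nat.Base using (ℕ; suc)
open import Data.Product.Base using (Σ; Σ-syntax; ∃-syntax; _×_; _,_; proj₁; swap)
open import Data.Sum.Base using (_⊎_)
open import Data.Unit.Base using (⊤)
open import Data.Vec.Functional using (Vector)
open import Function.Base using (_on_)
open import Function.Bundles using (Injection)
open import Induction.WellFounded using (Acc; acc; WellFounded)
open import Level using (0ℓ; _⊔_) renaming (suc to lsuc)
open import Relation.Binary.Bundles using (Setoid)
open import Relation.Binary.Morphism.Structures using (IsOrderIsomorphism)
open import Relation.Binary.PropositionalEquality.Properties using (setoid)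
open import Relation.Nullary.Decidable.Core using (yes; no)
open import Relation.Nullary.Negation.Core using (¬_)

-- The class of ordinals (relative to the universe Set of sets).
-- `lim A f` denotes the least ordinal strictly greater than every `f a`.
-- Different trees may denote the same ordinal, so equality of ordinals is
-- `_≈_` below.

data Ord : Set₁ where
  lim : (A : Set) → (A → Ord) → Ord

infix 4 _≤_ _<_ _≈_

_≤_ _<_ : Ord → Ord → Set
lim A f ≤ β       = (a : A) → f a < β
α       < lim B g = Σ[ b ∈ B ] α ≤ g b

_≈_ : Ord → Ord → Set
α ≈ β = α ≤ β × β ≤ α

𝟎 𝟏 : Ord
𝟎 = lim ⊥ λ ()
𝟏 = lim ⊤ λ _ → 𝟎

≤-refl : ∀ α → α ≤ α
≤-refl (lim A f) a = a , ≤-refl (f a)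

≤-trans : ∀ α β γ → α ≤ β → β ≤ γ → α ≤ γ
<-≤-trans : ∀ α β γ → α < β → β ≤ γ → α < γ
≤-<-trans : ∀ α β γ → α ≤ β → β < γ → α < γ
≤-trans (lim A f) β γ p q a = <-≤-trans (f a) β γ (p a) q
<-≤-trans α (lim B g) γ (b , p) q = ≤-<-trans α (g b) γ p (q b)
≤-<-trans α β (lim C h) p (c , q) = c , ≤-trans α β (h c) p q

<-wellFounded : WellFounded _<_
<-wellFounded (lim A f) = acc λ { {β} (a , β≤fa) → below β (f a) β≤fa (<-wellFounded (f a)) }
  where
  below : ∀ β γ → β ≤ γ → Acc _<_ γ → Acc _<_ β
  below β γ β≤γ (acc rs) = acc λ {δ} δ<β → rs (<-≤-trans δ β γ δ<β β≤γ)

Subclass : ∀ {ℓ} → (Ord → Set ℓ) → Setoid (lsuc 0ℓ ⊔ ℓ) 0ℓ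
Subclass S = record
  { Carrier       = Σ Ord S
  ; _≈_           = _≈_ on proj₁
  ; isEquivalence = record
    { refl  = λ {(α , _)} → ≤-refl α , ≤-refl α
    ; sym   = swap
    ; trans = λ { {α , _} {β , _} {γ , _} (p , p′) (q , q′) →
                  ≤-trans α β γ p q , ≤-trans γ β α q′ p′ }
    }
  }

-- An ordinal α is identified with the set of smaller ordinals, `_< α`.

Countable : Ord → Set₁
Countable α = Injection (Subclass (_< α)) (setoid ℕ)

IsFirstUncountable : Ord → Set₁
IsFirstUncountable α = ¬ Countable α × (∀ β → ¬ Countable β → α ≤ β)

HasOrderType : (Ord → Set₁) → Ord → Set₁
HasOrderType S α =
  ∃[ f ] IsOrderIsomorphism (Setoid._≈_ (Subclass S)) (Setoid._≈_ (Subclass (_< α)))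
                            (_<_ on proj₁) (_<_ on proj₁) f

IsMex : (Ord → Set₁) → Ord → Set₁
IsMex S γ = ¬ S γ × (∀ δ → ¬ S δ → γ ≤ δ)

-- Finding the least element of a nonempty class of ordinals needs excluded
-- middle, which is an explicit argument.  Applied to untruncated types, it also
-- supplies the choices made in ZFC.

module _ (em : ExcludedMiddle (lsuc 0ℓ)) where

  -- The value 𝟎 in the second case is never used: below, `mex` is only applied
  -- to images of sets, and these do not exhaust the ordinals.

  mex : (Ord → Set₁) → Ord
  mex S with em {∃[ γ ] IsMex S γ}
  ... | yes (γ , _) = γ
  ... | no  _       = 𝟎

  -- The recursions are on accessibility proofs, because α′ < α ranges over all
  -- smaller ordinals and not only over immediate subtrees of α.

  nimSum : ∀ α β → Acc _<_ α → Acc _<_ β → Ord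
  nimSum α β (acc rα) (acc rβ) = mex λ δ →
      (Σ[ α′ ∈ Ord ] Σ[ p ∈ α′ < α ] δ ≈ nimSum α′ β (rα p) (acc rβ))
    ⊎ (Σ[ β′ ∈ Ord ] Σ[ q ∈ β′ < β ] δ ≈ nimSum α β′ (acc rα) (rβ q))

  infixl 6 _⊕_
  _⊕_ : Ord → Ord → Ord
  α ⊕ β = nimSum α β (<-wellFounded α) (<-wellFounded β)

  nimProduct : ∀ α β → Acc _<_ α → Acc _<_ β → Ord
  nimProduct α β (acc rα) (acc rβ) = mex λ δ →
    Σ[ α′ ∈ Ord ] Σ[ p ∈ α′ < α ] Σ[ β′ ∈ Ord ] Σ[ q ∈ β′ < β ]
      δ ≈ nimProduct α′ β (rα p) (acc rβ)
        ⊕ nimProduct α β′ (acc rα) (rβ q)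
        ⊕ nimProduct α′ β′ (rα p) (rβ q)

  infixl 7 _⊗_
  _⊗_ : Ord → Ord → Ord
  α ⊗ β = nimProduct α β (<-wellFounded α) (<-wellFounded β)

  On₂ : RawSemiring (lsuc 0ℓ) 0ℓ
  On₂ = record
    { Carrier = Ord ; _≈_ = _≈_ ; _+_ = _⊕_ ; _*_ = _⊗_ ; 0# = 𝟎 ; 1# = 𝟏 }

  open RawSemiringDefs On₂ using (sum; _^_)

  record IsSubfield {ℓ} (S : Ord → Set ℓ) : Set (lsuc 0ℓ ⊔ ℓ) where
    field
      0-closed   : S 𝟎
      1-closed   : S 𝟏
      ⊕-closed   : ∀ x y → S x → S y → S (x ⊕ y)
      ⊗-closed   : ∀ x y → S x → S y → S (x ⊗ y)
      neg-closed : ∀ x → S x → ∃[ y ] S y × x ⊕ y ≈ 𝟎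
      inv-closed : ∀ x → S x → ¬ x ≈ 𝟎 → ∃[ y ] S y × x ⊗ y ≈ 𝟏

  -- Coefficients are listed with the constant term first.

  evalPoly : ∀ {n} → Vector Ord n → Ord → Ord
  evalPoly c x = sum λ i → c i ⊗ x ^ toℕ i

  -- Nonconstant polynomials are those of degree d + 1 for some d.

  IsAlgebraicallyClosed : ∀ {ℓ} → (Ord → Set ℓ) → Set (lsuc 0ℓ ⊔ ℓ)
  IsAlgebraicallyClosed S =
    ∀ d (c : Vector Ord (suc (suc d))) → (∀ i → S (c i)) → ¬ c (fromℕ (suc d)) ≈ 𝟎 →
    ∃[ x ] S x × evalPoly c x ≈ 𝟎

  IsTranscendental : Ord → Set₁
  IsTranscendental α = IsSubfield (_< α) × IsAlgebraicallyClosed (_< α)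

{-# OPTIONS --safe #-}

-- On₂ is a commutative ring of characteristic 2 without zero divisors (Conway's
-- inductions).  A countable ordinal can be enlarged to a countable ordinal Δ that is
-- closed under any countably many operations on ω₁.  Choosing the operations well,
-- Conway's simplest extension arguments apply to Δ: if all smaller nonzero α′ have
-- inverses in Δ and α has none, then Δ is the inverse of α; if all monic polynomials
-- of smaller degree, and the lexicographically earlier ones of the same degree, have
-- roots in Δ and g has none, then Δ is a root of g.  By well-founded induction all
-- inverses and roots are found below ω₁, so closing off under them shows that the
-- transcendental ordinals are unbounded in ω₁.  Since ω₁ is regular, the ranks of
-- these ordinals exhaust ω₁.

module Submission where

open import Algebra.Bundles using (CommutativeMonoid; CommutativeRing; RawRing; Semiring)
import Algebra.Definitions.RawSemiring as RawSemiringDefs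
import Algebra.Properties.Monoid.Sum
import Algebra.Solver.CommutativeMonoid
import Algebra.Solver.Ring
open import Algebra.Solver.Ring.AlmostCommutativeRing using (fromCommutativeRing; _-Raw-AlmostCommutative⟶_)
open import Axiom.ExcludedMiddle using (ExcludedMiddle)
open import Data.Bool.Base using (Bool; true; false)
import Data.Bool.Properties as Bool
open import Data.Empty using (⊥)
open import Data.Fin.Base using (toℕ; fromℕ; inject₁)
open import Data.Fin.Properties using (toℕ-inject₁; toℕ-fromℕ)
open import Data.Maybe.Base using (Maybe; just; nothing)
open import Data.Nat.Base as ℕ using (ℕ; zero; suc)
import Data.Nat.Induction as ℕ
import Data.Nat.Properties as ℕ
open import Data.Product.Base using (Σ; Σ-syntax; ∃-syntax; _×_; _,_; proj₁; proj₂; swap)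
open import Data.Sum.Base using (_⊎_; inj₁; inj₂; [_,_]′)
open import Data.Unit.Base using (⊤; tt)
open import Data.Vec.Base using (Vec; []; _∷_; map; zipWith)
open import Data.Vec.Functional using (Vector)
open import Data.Vec.Relation.Binary.Lex.Core using (length-equal)
open import Data.Vec.Relation.Binary.Lex.Strict as Lex using (Lex-<; this; next)
open import Data.Vec.Relation.Binary.Pointwise.Inductive as Pointwise using (Pointwise; []; _∷_)
open import Data.Vec.Relation.Unary.All as All using (All; []; _∷_)
open import Function.Base using (_∘_; id)
open import Function.Bundles using (Injection)
open import Induction.WellFounded using (Acc; acc; WellFounded)
open import Level using (Level; 0ℓ; _⊔_; Lift; lift; lower) renaming (suc to lsuc)
open import Relation.Binary.Bundles using (StrictTotalOrder)
open import Relation.Binary.Definitions using (Tri; tri<; tri≈; tri>)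
open import Relation.Binary.PropositionalEquality.Core as ≡ using (_≡_)
import Relation.Binary.Reasoning.Setoid
open import Relation.Nullary.Decidable.Core using (Dec; yes; no; map′; _⊎-dec_)
open import Relation.Nullary.Negation.Core using (¬_; contradiction)

-- Different trees may denote the same ordinal, and the operations on them recurse on accessibility
-- proofs and pick values by excluded middle. The algebra is therefore done over `NimArithmetic`,
-- which records of `_⊕_` and `_⊗_` only that they are mexes: no option equals the value, and
-- everything below the value is an option. Product options are best read as factorizations: in
-- characteristic 2, z is the option of x ⊗ y at (x′, y′) exactly when z ⊕ x ⊗ y equals (x ⊕ x′) ⊗
-- (y ⊕ y′). Applied to Δ ⊗ Δ ^ n, this writes every ordinal below Δ ^ suc n as the value at Δ of a
-- polynomial with coefficients below Δ, which is why comparing g(Δ) with Δ ^ suc n is informative.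
-- Inverses come before roots because the root argument divides by leading coefficients. During the
-- inductions, Δ can be closed only under inverses and roots already known to exist below ω₁, so the
-- closing off is parametrized by a predicate on elements and one on polynomials.

-- Nim arithmetic as two mex operations on a well-founded total order.

record NimArithmetic (a ℓ : Level) : Set (lsuc (a ⊔ ℓ)) where
  infixl 6 _⊕_
  infixl 7 _⊗_
  field
    strictTotalOrder : StrictTotalOrder a ℓ ℓ
  open StrictTotalOrder strictTotalOrder public
  field
    <-wellFounded : WellFounded _<_
    𝟎 𝟏           : Carrier
    _⊕_ _⊗_       : Carrier → Carrier → Carrier
    x≮𝟎           : ∀ {x} → ¬ x < 𝟎
    𝟎<𝟏           : 𝟎 < 𝟏
    x<𝟏⇒x≈𝟎       : ∀ {x} → x < 𝟏 → x ≈ 𝟎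
    ⊕-cong        : ∀ {x x′ y y′} → x ≈ x′ → y ≈ y′ → x ⊕ y ≈ x′ ⊕ y′
    ⊗-cong        : ∀ {x x′ y y′} → x ≈ x′ → y ≈ y′ → x ⊗ y ≈ x′ ⊗ y′
    ⊕-excludesˡ   : ∀ {x y x′} → x′ < x → ¬ x′ ⊕ y ≈ x ⊕ y
    ⊕-excludesʳ   : ∀ {x y y′} → y′ < y → ¬ x ⊕ y′ ≈ x ⊕ y
    <-⊕           : ∀ {x y z} → z < x ⊕ y →
                    (∃[ x′ ] x′ < x × z ≈ x′ ⊕ y) ⊎ (∃[ y′ ] y′ < y × z ≈ x ⊕ y′)
    ⊗-excludes    : ∀ {x y x′ y′} → x′ < x → y′ < y →
                    ¬ x′ ⊗ y ⊕ x ⊗ y′ ⊕ x′ ⊗ y′ ≈ x ⊗ y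
    <-⊗           : ∀ {x y z} → z < x ⊗ y →
                    ∃[ x′ ] x′ < x × ∃[ y′ ] y′ < y × z ≈ x′ ⊗ y ⊕ x ⊗ y′ ⊕ x′ ⊗ y′

-- The commutative ring of characteristic 2 and its lack of zero divisors.

module NimRing {a ℓ : Level} (N : NimArithmetic a ℓ) where
  open NimArithmetic N
  open Eq using (setoid; refl; sym) renaming (trans to ≈-trans)

  ≮⇒≈ : ∀ {x y} → ¬ x < y → ¬ y < x → x ≈ y
  ≮⇒≈ {x} {y} x≮y y≮x with compare x y
  ... | tri< x<y _ _ = contradiction x<y x≮y
  ... | tri≈ _ x≈y _ = x≈y
  ... | tri> _ _ y<x = contradiction y<x y≮x

  ⊕-congˡ : ∀ {x y z} → y ≈ z → x ⊕ y ≈ x ⊕ z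
  ⊕-congˡ = ⊕-cong refl

  ⊕-congʳ : ∀ {x y z} → y ≈ z → y ⊕ x ≈ z ⊕ x
  ⊕-congʳ y≈z = ⊕-cong y≈z refl

  ⊗-congˡ : ∀ {x y z} → y ≈ z → x ⊗ y ≈ x ⊗ z
  ⊗-congˡ = ⊗-cong refl

  ⊗-congʳ : ∀ {x y z} → y ≈ z → y ⊗ x ≈ z ⊗ x
  ⊗-congʳ y≈z = ⊗-cong y≈z refl

  ⊕-cancelˡ : ∀ {x y z} → x ⊕ y ≈ x ⊕ z → y ≈ z
  ⊕-cancelˡ eq = ≮⇒≈ (λ y<z → ⊕-excludesʳ y<z eq) (λ z<y → ⊕-excludesʳ z<y (sym eq))

  ⊕-cancelʳ : ∀ {x y z} → y ⊕ x ≈ z ⊕ x → y ≈ z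
  ⊕-cancelʳ eq = ≮⇒≈ (λ y<z → ⊕-excludesˡ y<z eq) (λ z<y → ⊕-excludesˡ z<y (sym eq))

  -- Minimality of the mex, as a tool for upper bounds. The identities below bound each side by the
  -- other: the induction hypothesis turns an option of one side into an option of the other, whose
  -- value it therefore cannot equal.
  ≮-⊕ : ∀ {x y z} → (∀ {x′} → x′ < x → ¬ x′ ⊕ y ≈ z) → (∀ {y′} → y′ < y → ¬ x ⊕ y′ ≈ z) →
        ¬ z < x ⊕ y
  ≮-⊕ l r z< with <-⊕ z<
  ... | inj₁ (_ , x′<x , eq) = l x′<x (sym eq)
  ... | inj₂ (_ , y′<y , eq) = r y′<y (sym eq)

  ⊕-comm : ∀ x y → x ⊕ y ≈ y ⊕ x
  ⊕-comm x y = go x y (<-wellFounded x) (<-wellFounded y)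
    where
    go : ∀ x y → Acc _<_ x → Acc _<_ y → x ⊕ y ≈ y ⊕ x
    go x y (acc rx) (acc ry) = ≮⇒≈
      (≮-⊕ (λ y′<y eq → ⊕-excludesʳ y′<y (≈-trans (go x _ (acc rx) (ry y′<y)) eq))
           (λ x′<x eq → ⊕-excludesˡ x′<x (≈-trans (go _ y (rx x′<x) (acc ry)) eq)))
      (≮-⊕ (λ x′<x eq → ⊕-excludesʳ x′<x (≈-trans (sym (go _ y (rx x′<x) (acc ry))) eq))
           (λ y′<y eq → ⊕-excludesˡ y′<y (≈-trans (sym (go x _ (acc rx) (ry y′<y))) eq)))

  ⊕-identityʳ : ∀ x → x ⊕ 𝟎 ≈ x
  ⊕-identityʳ x = go x (<-wellFounded x)
    where
    go : ∀ x → Acc _<_ x → x ⊕ 𝟎 ≈ x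
    go x (acc rx) = ≮⇒≈
      (λ w<x → ⊕-excludesˡ w<x (go _ (rx w<x)))
      (≮-⊕ (λ x′<x eq → irrefl (≈-trans (sym (go _ (rx x′<x))) eq) x′<x)
           (λ y<𝟎 _ → x≮𝟎 y<𝟎))

  ⊕-self : ∀ x → x ⊕ x ≈ 𝟎
  ⊕-self x = go x (<-wellFounded x)
    where
    go : ∀ x → Acc _<_ x → x ⊕ x ≈ 𝟎
    go x (acc rx) = ≮⇒≈ x≮𝟎
      (≮-⊕ (λ x′<x eq → ⊕-excludesʳ x′<x (≈-trans (go _ (rx x′<x)) (sym eq)))
           (λ x′<x eq → ⊕-excludesˡ x′<x (≈-trans (go _ (rx x′<x)) (sym eq))))

  ⊕-assoc : ∀ x y z → (x ⊕ y) ⊕ z ≈ x ⊕ (y ⊕ z)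
  ⊕-assoc x y z = go x y z (<-wellFounded x) (<-wellFounded y) (<-wellFounded z)
    where
    go : ∀ x y z → Acc _<_ x → Acc _<_ y → Acc _<_ z → (x ⊕ y) ⊕ z ≈ x ⊕ (y ⊕ z)
    go x y z (acc rx) (acc ry) (acc rz) = ≮⇒≈
      (≮-⊕ (λ x′<x eq → ⊕-excludesˡ (x′<x) (⊕-cancelʳ (≈-trans (atˡ x′<x) eq)))
           yz)
      (≮-⊕ xy
           (λ z′<z eq → ⊕-excludesʳ z′<z (⊕-cancelˡ (≈-trans (sym (atʳ z′<z)) eq))))
      where
      atˡ : ∀ {x′} → x′ < x → (x′ ⊕ y) ⊕ z ≈ x′ ⊕ (y ⊕ z)
      atˡ x′<x = go _ y z (rx x′<x) (acc ry) (acc rz)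
      atᵐ : ∀ {y′} → y′ < y → (x ⊕ y′) ⊕ z ≈ x ⊕ (y′ ⊕ z)
      atᵐ y′<y = go x _ z (acc rx) (ry y′<y) (acc rz)
      atʳ : ∀ {z′} → z′ < z → (x ⊕ y) ⊕ z′ ≈ x ⊕ (y ⊕ z′)
      atʳ z′<z = go x y _ (acc rx) (acc ry) (rz z′<z)
      yz : ∀ {w} → w < y ⊕ z → ¬ x ⊕ w ≈ (x ⊕ y) ⊕ z
      yz w<y⊕z eq with <-⊕ w<y⊕z
      ... | inj₁ (_ , y′<y , w≈) = ⊕-excludesʳ y′<y (⊕-cancelʳ
              (≈-trans (≈-trans (atᵐ y′<y) (⊕-congˡ (sym w≈))) eq))
      ... | inj₂ (_ , z′<z , w≈) = ⊕-excludesʳ z′<z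
              (≈-trans (≈-trans (atʳ z′<z) (⊕-congˡ (sym w≈))) eq)
      xy : ∀ {w} → w < x ⊕ y → ¬ w ⊕ z ≈ x ⊕ (y ⊕ z)
      xy w<x⊕y eq with <-⊕ w<x⊕y
      ... | inj₁ (_ , x′<x , w≈) = ⊕-excludesˡ x′<x
              (≈-trans (≈-trans (sym (atˡ x′<x)) (⊕-congʳ (sym w≈))) eq)
      ... | inj₂ (_ , y′<y , w≈) = ⊕-excludesˡ y′<y (⊕-cancelˡ
              (≈-trans (≈-trans (sym (atᵐ y′<y)) (⊕-congʳ (sym w≈))) eq))

  ⊕-identityˡ : ∀ x → 𝟎 ⊕ x ≈ x
  ⊕-identityˡ x = ≈-trans (⊕-comm 𝟎 x) (⊕-identityʳ x)

  ⊕-𝟎-commutativeMonoid : CommutativeMonoid a ℓ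
  ⊕-𝟎-commutativeMonoid = record
    { isCommutativeMonoid = record
      { isMonoid = record
        { isSemigroup = record
          { isMagma = record { isEquivalence = isEquivalence ; ∙-cong = ⊕-cong }
          ; assoc = ⊕-assoc }
        ; identity = ⊕-identityˡ , ⊕-identityʳ }
      ; comm = ⊕-comm } }

  private
    module ⊕-Solver = Algebra.Solver.CommutativeMonoid ⊕-𝟎-commutativeMonoid
    open ⊕-Solver using (solve; _⊜_) renaming (_⊕_ to infixl 6 _:⊕_)
  open Relation.Binary.Reasoning.Setoid setoid

  ≮-⊗ : ∀ {x y z} →
        (∀ {x′ y′} → x′ < x → y′ < y → ¬ x′ ⊗ y ⊕ x ⊗ y′ ⊕ x′ ⊗ y′ ≈ z) → ¬ z < x ⊗ y
  ≮-⊗ h z< with <-⊗ z<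
  ... | _ , x′<x , _ , y′<y , eq = h x′<x y′<y (sym eq)

  ⊗-zeroʳ : ∀ x → x ⊗ 𝟎 ≈ 𝟎
  ⊗-zeroʳ x = ≮⇒≈ x≮𝟎 (≮-⊗ λ _ y′<𝟎 _ → x≮𝟎 y′<𝟎)

  ⊗-comm : ∀ x y → x ⊗ y ≈ y ⊗ x
  ⊗-comm x y = go x y (<-wellFounded x) (<-wellFounded y)
    where
    swapped : ∀ {p q r p′ q′ r′} → p ≈ p′ → q ≈ q′ → r ≈ r′ → p ⊕ q ⊕ r ≈ q′ ⊕ p′ ⊕ r′
    swapped p q r = ⊕-cong (≈-trans (⊕-comm _ _) (⊕-cong q p)) r
    go : ∀ x y → Acc _<_ x → Acc _<_ y → x ⊗ y ≈ y ⊗ x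
    go x y (acc rx) (acc ry) = ≮⇒≈
      (≮-⊗ λ y′<y x′<x eq → ⊗-excludes x′<x y′<y (≈-trans
        (swapped (go _ y (rx x′<x) (acc ry)) (go x _ (acc rx) (ry y′<y)) (go _ _ (rx x′<x) (ry y′<y)))
        eq))
      (≮-⊗ λ x′<x y′<y eq → ⊗-excludes y′<y x′<x (≈-trans
        (swapped (sym (go x _ (acc rx) (ry y′<y))) (sym (go _ y (rx x′<x) (acc ry)))
                 (sym (go _ _ (rx x′<x) (ry y′<y))))
        eq))

  ⊗-zeroˡ : ∀ x → 𝟎 ⊗ x ≈ 𝟎
  ⊗-zeroˡ x = ≈-trans (⊗-comm 𝟎 x) (⊗-zeroʳ x)

  ⊗-identityʳ : ∀ x → x ⊗ 𝟏 ≈ x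
  ⊗-identityʳ x = go x (<-wellFounded x)
    where
    option : ∀ {x x′ y′} → x′ ⊗ 𝟏 ≈ x′ → y′ ≈ 𝟎 → x′ ⊗ 𝟏 ⊕ x ⊗ y′ ⊕ x′ ⊗ y′ ≈ x′
    option {x} {x′} {y′} ih y′≈𝟎 = begin
      x′ ⊗ 𝟏 ⊕ x ⊗ y′ ⊕ x′ ⊗ y′ ≈⟨ ⊕-cong (⊕-cong ih (⊗-congˡ y′≈𝟎)) (⊗-congˡ y′≈𝟎) ⟩
      x′ ⊕ x ⊗ 𝟎 ⊕ x′ ⊗ 𝟎       ≈⟨ ⊕-cong (⊕-congˡ (⊗-zeroʳ x)) (⊗-zeroʳ x′) ⟩
      x′ ⊕ 𝟎 ⊕ 𝟎                ≈⟨ ⊕-identityʳ _ ⟩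
      x′ ⊕ 𝟎                    ≈⟨ ⊕-identityʳ _ ⟩
      x′                        ∎
    go : ∀ x → Acc _<_ x → x ⊗ 𝟏 ≈ x
    go x (acc rx) = ≮⇒≈
      (λ w<x → ⊗-excludes w<x 𝟎<𝟏 (option (go _ (rx w<x)) refl))
      (≮-⊗ λ x′<x y′<𝟏 eq →
        irrefl (≈-trans (sym (option (go _ (rx x′<x)) (x<𝟏⇒x≈𝟎 y′<𝟏))) eq) x′<x)

  ≈⇒⊕≈𝟎 : ∀ {x y} → x ≈ y → x ⊕ y ≈ 𝟎
  ≈⇒⊕≈𝟎 x≈y = ≈-trans (⊕-congʳ x≈y) (⊕-self _)

  ⊕≈𝟎⇒≈ : ∀ {x y} → x ⊕ y ≈ 𝟎 → x ≈ y
  ⊕≈𝟎⇒≈ eq = ⊕-cancelʳ (≈-trans eq (sym (⊕-self _)))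

  -- The excluded equation is (x ⊕ x′) ⊗ (y ⊕ y′) ≈ 𝟎 multiplied out, which is
  -- symmetric under exchanging x with x′ and y with y′.
  ⊗-excludes-≉ : ∀ {x y x′ y′} → ¬ x′ ≈ x → ¬ y′ ≈ y → ¬ x′ ⊗ y ⊕ x ⊗ y′ ⊕ x′ ⊗ y′ ≈ x ⊗ y
  ⊗-excludes-≉ {x} {y} {x′} {y′} x′≉x y′≉y eq with compare x′ x | compare y′ y
  ... | tri≈ _ x′≈x _ | _             = x′≉x x′≈x
  ... | tri< _ _ _    | tri≈ _ y′≈y _ = y′≉y y′≈y
  ... | tri> _ _ _    | tri≈ _ y′≈y _ = y′≉y y′≈y
  ... | tri< x′<x _ _ | tri< y′<y _ _ = ⊗-excludes x′<x y′<y eq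
  ... | tri< x′<x _ _ | tri> _ _ y<y′ = ⊗-excludes x′<x y<y′ (⊕≈𝟎⇒≈ (≈-trans
    (solve 4 (λ a b c d → d :⊕ a :⊕ b :⊕ c ⊜ b :⊕ c :⊕ d :⊕ a) refl
      (x ⊗ y) (x′ ⊗ y) (x ⊗ y′) (x′ ⊗ y′))
    (≈⇒⊕≈𝟎 eq)))
  ... | tri> _ _ x<x′ | tri< y′<y _ _ = ⊗-excludes x<x′ y′<y (⊕≈𝟎⇒≈ (≈-trans
    (solve 4 (λ a b c d → a :⊕ d :⊕ c :⊕ b ⊜ b :⊕ c :⊕ d :⊕ a) refl
      (x ⊗ y) (x′ ⊗ y) (x ⊗ y′) (x′ ⊗ y′))
    (≈⇒⊕≈𝟎 eq)))
  ... | tri> _ _ x<x′ | tri> _ _ y<y′ = ⊗-excludes x<x′ y<y′ (⊕≈𝟎⇒≈ (≈-trans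
    (solve 4 (λ a b c d → c :⊕ b :⊕ a :⊕ d ⊜ b :⊕ c :⊕ d :⊕ a) refl
      (x ⊗ y) (x′ ⊗ y) (x ⊗ y′) (x′ ⊗ y′))
    (≈⇒⊕≈𝟎 eq)))

  <⇒≉ : ∀ {x y} → x < y → ¬ x ≈ y
  <⇒≉ x<y x≈y = irrefl x≈y x<y

  -- By the induction hypothesis, the option of `(x ⊕ y) ⊗ z` at `x′ ⊕ y` and `z′` is the option of
  -- `x ⊗ z` at `x′` and `z′` plus `y ⊗ z`, and similarly for `y′`. Since `x′ ⊕ y` may exceed
  -- `x ⊕ y`, exclusion is needed for unequal arguments and not only for smaller ones.
  ⊗-distribʳ-⊕ : ∀ z x y → (x ⊕ y) ⊗ z ≈ x ⊗ z ⊕ y ⊗ z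
  ⊗-distribʳ-⊕ z x y = go z x y (<-wellFounded z) (<-wellFounded x) (<-wellFounded y)
    where
    go : ∀ z x y → Acc _<_ z → Acc _<_ x → Acc _<_ y → (x ⊕ y) ⊗ z ≈ x ⊗ z ⊕ y ⊗ z
    go z x y (acc rz) (acc rx) (acc ry) = ≮⇒≈
      (≮-⊕ left right)
      (≮-⊗ split)
      where
      expandˡ : ∀ {x′ z′} → x′ < x → z′ < z →
                (x′ ⊕ y) ⊗ z ⊕ (x ⊕ y) ⊗ z′ ⊕ (x′ ⊕ y) ⊗ z′ ≈
                (x′ ⊗ z ⊕ x ⊗ z′ ⊕ x′ ⊗ z′) ⊕ y ⊗ z
      expandˡ {x′} {z′} x′<x z′<z = begin
        (x′ ⊕ y) ⊗ z ⊕ (x ⊕ y) ⊗ z′ ⊕ (x′ ⊕ y) ⊗ z′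
          ≈⟨ ⊕-cong (⊕-cong (go z x′ y (acc rz) (rx x′<x) (acc ry))
                            (go z′ x y (rz z′<z) (acc rx) (acc ry)))
                    (go z′ x′ y (rz z′<z) (rx x′<x) (acc ry)) ⟩
        (x′ ⊗ z ⊕ y ⊗ z) ⊕ (x ⊗ z′ ⊕ y ⊗ z′) ⊕ (x′ ⊗ z′ ⊕ y ⊗ z′)
          ≈⟨ solve 5 (λ a b c d e → ((a :⊕ b) :⊕ (c :⊕ d)) :⊕ (e :⊕ d) ⊜
                                    (((a :⊕ c) :⊕ e) :⊕ b) :⊕ (d :⊕ d)) refl
               (x′ ⊗ z) (y ⊗ z) (x ⊗ z′) (y ⊗ z′) (x′ ⊗ z′) ⟩
        (x′ ⊗ z ⊕ x ⊗ z′ ⊕ x′ ⊗ z′) ⊕ y ⊗ z ⊕ (y ⊗ z′ ⊕ y ⊗ z′)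
          ≈⟨ ⊕-congˡ (⊕-self _) ⟩
        (x′ ⊗ z ⊕ x ⊗ z′ ⊕ x′ ⊗ z′) ⊕ y ⊗ z ⊕ 𝟎
          ≈⟨ ⊕-identityʳ _ ⟩
        (x′ ⊗ z ⊕ x ⊗ z′ ⊕ x′ ⊗ z′) ⊕ y ⊗ z ∎
      expandʳ : ∀ {y′ z′} → y′ < y → z′ < z →
                (x ⊕ y′) ⊗ z ⊕ (x ⊕ y) ⊗ z′ ⊕ (x ⊕ y′) ⊗ z′ ≈
                x ⊗ z ⊕ (y′ ⊗ z ⊕ y ⊗ z′ ⊕ y′ ⊗ z′)
      expandʳ {y′} {z′} y′<y z′<z = begin
        (x ⊕ y′) ⊗ z ⊕ (x ⊕ y) ⊗ z′ ⊕ (x ⊕ y′) ⊗ z′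
          ≈⟨ ⊕-cong (⊕-cong (go z x y′ (acc rz) (acc rx) (ry y′<y))
                            (go z′ x y (rz z′<z) (acc rx) (acc ry)))
                    (go z′ x y′ (rz z′<z) (acc rx) (ry y′<y)) ⟩
        (x ⊗ z ⊕ y′ ⊗ z) ⊕ (x ⊗ z′ ⊕ y ⊗ z′) ⊕ (x ⊗ z′ ⊕ y′ ⊗ z′)
          ≈⟨ solve 5 (λ a b c d e → ((b :⊕ a) :⊕ (d :⊕ c)) :⊕ (d :⊕ e) ⊜
                                    (b :⊕ ((a :⊕ c) :⊕ e)) :⊕ (d :⊕ d)) refl
               (y′ ⊗ z) (x ⊗ z) (y ⊗ z′) (x ⊗ z′) (y′ ⊗ z′) ⟩
        x ⊗ z ⊕ (y′ ⊗ z ⊕ y ⊗ z′ ⊕ y′ ⊗ z′) ⊕ (x ⊗ z′ ⊕ x ⊗ z′)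
          ≈⟨ ⊕-congˡ (⊕-self _) ⟩
        x ⊗ z ⊕ (y′ ⊗ z ⊕ y ⊗ z′ ⊕ y′ ⊗ z′) ⊕ 𝟎
          ≈⟨ ⊕-identityʳ _ ⟩
        x ⊗ z ⊕ (y′ ⊗ z ⊕ y ⊗ z′ ⊕ y′ ⊗ z′) ∎
      split : ∀ {w z′} → w < x ⊕ y → z′ < z →
              ¬ w ⊗ z ⊕ (x ⊕ y) ⊗ z′ ⊕ w ⊗ z′ ≈ x ⊗ z ⊕ y ⊗ z
      split w<x⊕y z′<z eq with <-⊕ w<x⊕y
      ... | inj₁ (_ , x′<x , w≈) = ⊗-excludes x′<x z′<z (⊕-cancelʳ (≈-trans
              (sym (≈-trans (⊕-cong (⊕-congʳ (⊗-congʳ w≈)) (⊗-congʳ w≈)) (expandˡ x′<x z′<z))) eq))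
      ... | inj₂ (_ , y′<y , w≈) = ⊗-excludes y′<y z′<z (⊕-cancelˡ (≈-trans
              (sym (≈-trans (⊕-cong (⊕-congʳ (⊗-congʳ w≈)) (⊗-congʳ w≈)) (expandʳ y′<y z′<z))) eq))
      left : ∀ {w} → w < x ⊗ z → ¬ w ⊕ y ⊗ z ≈ (x ⊕ y) ⊗ z
      left w<xz eq with <-⊗ w<xz
      ... | _ , x′<x , _ , z′<z , w≈ = ⊗-excludes-≉
              (λ x′⊕y≈x⊕y → <⇒≉ x′<x (⊕-cancelʳ x′⊕y≈x⊕y)) (<⇒≉ z′<z)
              (≈-trans (≈-trans (expandˡ x′<x z′<z) (⊕-congʳ (sym w≈))) eq)
      right : ∀ {w} → w < y ⊗ z → ¬ x ⊗ z ⊕ w ≈ (x ⊕ y) ⊗ z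
      right w<yz eq with <-⊗ w<yz
      ... | _ , y′<y , _ , z′<z , w≈ = ⊗-excludes-≉
              (λ x⊕y′≈x⊕y → <⇒≉ y′<y (⊕-cancelˡ x⊕y′≈x⊕y)) (<⇒≉ z′<z)
              (≈-trans (≈-trans (expandʳ y′<y z′<z) (⊕-congˡ (sym w≈))) eq)

  ⊗-distribˡ-⊕ : ∀ z x y → z ⊗ (x ⊕ y) ≈ z ⊗ x ⊕ z ⊗ y
  ⊗-distribˡ-⊕ z x y = begin
    z ⊗ (x ⊕ y)   ≈⟨ ⊗-comm z _ ⟩
    (x ⊕ y) ⊗ z   ≈⟨ ⊗-distribʳ-⊕ z x y ⟩
    x ⊗ z ⊕ y ⊗ z ≈⟨ ⊕-cong (⊗-comm x z) (⊗-comm y z) ⟩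
    z ⊗ x ⊕ z ⊗ y ∎

  private
    distribʳ₃ : ∀ p q r z → (p ⊕ q ⊕ r) ⊗ z ≈ p ⊗ z ⊕ q ⊗ z ⊕ r ⊗ z
    distribʳ₃ p q r z = ≈-trans (⊗-distribʳ-⊕ z _ r) (⊕-congʳ (⊗-distribʳ-⊕ z p q))

    distribˡ₃ : ∀ z p q r → z ⊗ (p ⊕ q ⊕ r) ≈ z ⊗ p ⊕ z ⊗ q ⊕ z ⊗ r
    distribˡ₃ z p q r = ≈-trans (⊗-distribˡ-⊕ z _ r) (⊕-congʳ (⊗-distribˡ-⊕ z p q))

  -- Options of nested products agree because both expand (x ⊕ x′)(y ⊕ y′)(z ⊕ z′) ⊕ xyz. The inner
  -- option `v` or `w` need not lie below the product it comes from; that it differs from it is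
  -- enough for `⊗-excludes-≉`.
  ⊗-assoc : ∀ x y z → (x ⊗ y) ⊗ z ≈ x ⊗ (y ⊗ z)
  ⊗-assoc x y z = go x y z (<-wellFounded x) (<-wellFounded y) (<-wellFounded z)
    where
    go : ∀ x y z → Acc _<_ x → Acc _<_ y → Acc _<_ z → (x ⊗ y) ⊗ z ≈ x ⊗ (y ⊗ z)
    go x y z (acc rx) (acc ry) (acc rz) = ≮⇒≈ (≮-⊗ right) (≮-⊗ left)
      where
      expand : ∀ {x′ y′ z′} → x′ < x → y′ < y → z′ < z →
               let v = x′ ⊗ y ⊕ x ⊗ y′ ⊕ x′ ⊗ y′
                   w = y′ ⊗ z ⊕ y ⊗ z′ ⊕ y′ ⊗ z′
               in v ⊗ z ⊕ (x ⊗ y) ⊗ z′ ⊕ v ⊗ z′ ≈ x′ ⊗ (y ⊗ z) ⊕ x ⊗ w ⊕ x′ ⊗ w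
      expand {x′} {y′} {z′} x′<x y′<y z′<z = begin
        (x′ ⊗ y ⊕ x ⊗ y′ ⊕ x′ ⊗ y′) ⊗ z ⊕ (x ⊗ y) ⊗ z′ ⊕ (x′ ⊗ y ⊕ x ⊗ y′ ⊕ x′ ⊗ y′) ⊗ z′
          ≈⟨ ⊕-cong (⊕-congʳ (distribʳ₃ _ _ _ z)) (distribʳ₃ _ _ _ z′) ⟩
        ((x′ ⊗ y) ⊗ z ⊕ (x ⊗ y′) ⊗ z ⊕ (x′ ⊗ y′) ⊗ z) ⊕ (x ⊗ y) ⊗ z′ ⊕
        ((x′ ⊗ y) ⊗ z′ ⊕ (x ⊗ y′) ⊗ z′ ⊕ (x′ ⊗ y′) ⊗ z′)
          ≈⟨ ⊕-cong (⊕-cong (⊕-cong (⊕-cong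
               (go x′ y z (rx x′<x) (acc ry) (acc rz))
               (go x y′ z (acc rx) (ry y′<y) (acc rz)))
               (go x′ y′ z (rx x′<x) (ry y′<y) (acc rz)))
               (go x y z′ (acc rx) (acc ry) (rz z′<z)))
               (⊕-cong (⊕-cong
               (go x′ y z′ (rx x′<x) (acc ry) (rz z′<z))
               (go x y′ z′ (acc rx) (ry y′<y) (rz z′<z)))
               (go x′ y′ z′ (rx x′<x) (ry y′<y) (rz z′<z))) ⟩
        (x′ ⊗ (y ⊗ z) ⊕ x ⊗ (y′ ⊗ z) ⊕ x′ ⊗ (y′ ⊗ z)) ⊕ x ⊗ (y ⊗ z′) ⊕
        (x′ ⊗ (y ⊗ z′) ⊕ x ⊗ (y′ ⊗ z′) ⊕ x′ ⊗ (y′ ⊗ z′))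
          ≈⟨ solve 7 (λ a b c d e f g →
               (((a :⊕ b) :⊕ c) :⊕ d) :⊕ ((e :⊕ f) :⊕ g) ⊜
               (a :⊕ ((b :⊕ d) :⊕ f)) :⊕ ((c :⊕ e) :⊕ g)) refl
               (x′ ⊗ (y ⊗ z)) (x ⊗ (y′ ⊗ z)) (x′ ⊗ (y′ ⊗ z)) (x ⊗ (y ⊗ z′))
               (x′ ⊗ (y ⊗ z′)) (x ⊗ (y′ ⊗ z′)) (x′ ⊗ (y′ ⊗ z′)) ⟩
        x′ ⊗ (y ⊗ z) ⊕ (x ⊗ (y′ ⊗ z) ⊕ x ⊗ (y ⊗ z′) ⊕ x ⊗ (y′ ⊗ z′)) ⊕
        (x′ ⊗ (y′ ⊗ z) ⊕ x′ ⊗ (y ⊗ z′) ⊕ x′ ⊗ (y′ ⊗ z′))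
          ≈⟨ ⊕-cong (⊕-congˡ (distribˡ₃ x _ _ _)) (distribˡ₃ x′ _ _ _) ⟨
        x′ ⊗ (y ⊗ z) ⊕ x ⊗ (y′ ⊗ z ⊕ y ⊗ z′ ⊕ y′ ⊗ z′) ⊕ x′ ⊗ (y′ ⊗ z ⊕ y ⊗ z′ ⊕ y′ ⊗ z′) ∎
      left : ∀ {v z′} → v < x ⊗ y → z′ < z →
             ¬ v ⊗ z ⊕ (x ⊗ y) ⊗ z′ ⊕ v ⊗ z′ ≈ x ⊗ (y ⊗ z)
      left v<xy z′<z eq with <-⊗ v<xy
      ... | _ , x′<x , _ , y′<y , v≈ = ⊗-excludes-≉
              (<⇒≉ x′<x) (⊗-excludes y′<y z′<z)
              (≈-trans (sym (≈-trans (⊕-cong (⊕-congʳ (⊗-congʳ v≈)) (⊗-congʳ v≈))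
                                     (expand x′<x y′<y z′<z))) eq)
      right : ∀ {x′ w} → x′ < x → w < y ⊗ z →
              ¬ x′ ⊗ (y ⊗ z) ⊕ x ⊗ w ⊕ x′ ⊗ w ≈ (x ⊗ y) ⊗ z
      right x′<x w<yz eq with <-⊗ w<yz
      ... | _ , y′<y , _ , z′<z , w≈ = ⊗-excludes-≉
              (⊗-excludes x′<x y′<y) (<⇒≉ z′<z)
              (≈-trans (≈-trans (expand x′<x y′<y z′<z)
                                (sym (⊕-cong (⊕-congˡ (⊗-congˡ w≈)) (⊗-congˡ w≈)))) eq)

  ≉𝟎⇒𝟎< : ∀ {x} → ¬ x ≈ 𝟎 → 𝟎 < x
  ≉𝟎⇒𝟎< {x} x≉𝟎 with compare 𝟎 x
  ... | tri< 𝟎<x _ _ = 𝟎<x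
  ... | tri≈ _ 𝟎≈x _ = contradiction (sym 𝟎≈x) x≉𝟎
  ... | tri> _ _ x<𝟎 = contradiction x<𝟎 x≮𝟎

  -- For nonzero factors, `𝟎` is the option at `𝟎` and `𝟎`, hence not the value.
  x⊗y≉𝟎 : ∀ {x y} → ¬ x ≈ 𝟎 → ¬ y ≈ 𝟎 → ¬ x ⊗ y ≈ 𝟎
  x⊗y≉𝟎 {x} {y} x≉𝟎 y≉𝟎 xy≈𝟎 = ⊗-excludes (≉𝟎⇒𝟎< x≉𝟎) (≉𝟎⇒𝟎< y≉𝟎) (begin
    𝟎 ⊗ y ⊕ x ⊗ 𝟎 ⊕ 𝟎 ⊗ 𝟎 ≈⟨ ⊕-cong (⊕-cong (⊗-zeroˡ y) (⊗-zeroʳ x)) (⊗-zeroʳ 𝟎) ⟩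
    𝟎 ⊕ 𝟎 ⊕ 𝟎             ≈⟨ ⊕-identityʳ _ ⟩
    𝟎 ⊕ 𝟎                 ≈⟨ ⊕-identityʳ _ ⟩
    𝟎                     ≈⟨ xy≈𝟎 ⟨
    x ⊗ y                 ∎)

  commutativeRing : CommutativeRing a ℓ
  commutativeRing = record
    { Carrier = Carrier ; _≈_ = _≈_ ; _+_ = _⊕_ ; _*_ = _⊗_ ; -_ = id ; 0# = 𝟎 ; 1# = 𝟏
    ; isCommutativeRing = record
      { isRing = record
        { +-isAbelianGroup = record
          { isGroup = record
            { isMonoid = CommutativeMonoid.isMonoid ⊕-𝟎-commutativeMonoid
            ; inverse = ⊕-self , ⊕-self
            ; ⁻¹-cong = id }
          ; comm = ⊕-comm }
        ; *-cong = ⊗-cong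
        ; *-assoc = ⊗-assoc
        ; *-identity = (λ x → ≈-trans (⊗-comm 𝟏 x) (⊗-identityʳ x)) , ⊗-identityʳ
        ; distrib = ⊗-distribˡ-⊕ , ⊗-distribʳ-⊕ }
      ; *-comm = ⊗-comm } }

-- Polynomials over the nim ring.

module NimPolynomial {a ℓ : Level} (N : NimArithmetic a ℓ) where
  open NimArithmetic N
  open NimRing N
  open Eq using (setoid; refl; sym) renaming (trans to ≈-trans)
  open RawSemiringDefs (Semiring.rawSemiring (CommutativeRing.semiring commutativeRing)) public using (_^_; sum)
  open Algebra.Properties.Monoid.Sum (CommutativeMonoid.monoid ⊕-𝟎-commutativeMonoid)
    using (sum-init-last; sum-cong-≗)
  open Relation.Binary.Reasoning.Setoid setoid

  private
    𝔽₂ : RawRing _ _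
    𝔽₂ = CommutativeRing.rawRing Bool.xor-∧-commutativeRing

    ⟦_⟧₂ : Bool → Carrier
    ⟦ false ⟧₂ = 𝟎
    ⟦ true  ⟧₂ = 𝟏

    -- With coefficients in the field of two elements, the ring solver cancels equal summands in
    -- pairs.
    fromBool : 𝔽₂ -Raw-AlmostCommutative⟶ fromCommutativeRing commutativeRing
    fromBool = record
      { ⟦_⟧    = ⟦_⟧₂
      ; +-homo = λ { false y → sym (⊕-identityˡ _)
                   ; true false → sym (⊕-identityʳ _)
                   ; true true → sym (⊕-self _) }
      ; *-homo = λ { false y → sym (⊗-zeroˡ _)
                   ; true y → sym (≈-trans (⊗-comm _ _) (⊗-identityʳ _)) }
      ; -‿homo = λ _ → refl
      ; 0-homo = refl
      ; 1-homo = refl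
      }

    _≟₂_ : ∀ x y → Maybe (⟦ x ⟧₂ ≈ ⟦ y ⟧₂)
    false ≟₂ false = just refl
    true  ≟₂ true  = just refl
    _     ≟₂ _     = nothing

  open Algebra.Solver.Ring 𝔽₂ (fromCommutativeRing commutativeRing) fromBool _≟₂_
    using (solve; _:=_; _:+_; _:*_; con)

  ^-cong : ∀ n {x y} → x ≈ y → x ^ n ≈ y ^ n
  ^-cong zero    x≈y = refl
  ^-cong (suc n) x≈y = ⊗-cong x≈y (^-cong n x≈y)

  -- Coefficients are listed with the leading one first, so that the relevant
  -- order on polynomials is the lexicographic one on vectors.
  poly : ∀ {n} → Vec Carrier n → Carrier → Carrier
  poly []                x = 𝟎
  poly {suc n} (a ∷ c) x = a ⊗ x ^ n ⊕ poly c x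

  -- The leading coefficient 1 is implicit, so a vector of length `n` encodes a polynomial of degree
  -- `n`, and length `suc n` means nonconstant.
  monic : ∀ {n} → Vec Carrier n → Carrier → Carrier
  monic {n} c x = x ^ n ⊕ poly c x

  poly-cong : ∀ {n} {c d : Vec Carrier n} {x y} → Pointwise _≈_ c d → x ≈ y → poly c x ≈ poly d y
  poly-cong []                    x≈y = refl
  poly-cong {suc n} (a≈b ∷ c≋d) x≈y = ⊕-cong (⊗-cong a≈b (^-cong n x≈y)) (poly-cong c≋d x≈y)

  monic-cong : ∀ {n} {c d : Vec Carrier n} {x y} → Pointwise _≈_ c d → x ≈ y → monic c x ≈ monic d y
  monic-cong {n} c≋d x≈y = ⊕-cong (^-cong n x≈y) (poly-cong c≋d x≈y)

  poly-⊗ : ∀ s {n} (c : Vec Carrier n) x → poly (map (s ⊗_) c) x ≈ s ⊗ poly c x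
  poly-⊗ s []      x = sym (⊗-zeroʳ s)
  poly-⊗ s {suc n} (a ∷ c) x = begin
    s ⊗ a ⊗ x ^ n ⊕ poly (map (s ⊗_) c) x ≈⟨ ⊕-congˡ (poly-⊗ s c x) ⟩
    s ⊗ a ⊗ x ^ n ⊕ s ⊗ poly c x
      ≈⟨ solve 4 (λ s a u p → s :* a :* u :+ s :* p := s :* (a :* u :+ p)) refl s a (x ^ n) (poly c x) ⟩
    s ⊗ (a ⊗ x ^ n ⊕ poly c x) ∎

  poly-⊕ : ∀ {n} (c d : Vec Carrier n) x → poly (zipWith _⊕_ c d) x ≈ poly c x ⊕ poly d x
  poly-⊕ []      []      x = sym (⊕-identityʳ 𝟎)
  poly-⊕ {suc n} (a ∷ c) (b ∷ d) x = begin
    (a ⊕ b) ⊗ x ^ n ⊕ poly (zipWith _⊕_ c d) x ≈⟨ ⊕-congˡ (poly-⊕ c d x) ⟩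
    (a ⊕ b) ⊗ x ^ n ⊕ (poly c x ⊕ poly d x)
      ≈⟨ solve 5 (λ a b u p q → (a :+ b) :* u :+ (p :+ q) := a :* u :+ p :+ (b :* u :+ q)) refl
           a b (x ^ n) (poly c x) (poly d x) ⟩
    a ⊗ x ^ n ⊕ poly c x ⊕ (b ⊗ x ^ n ⊕ poly d x) ∎

  leadingFirst : ∀ {n} → Vector Carrier n → Vec Carrier n
  leadingFirst {zero}  c = []
  leadingFirst {suc n} c = c (fromℕ n) ∷ leadingFirst (c ∘ inject₁)

  leadingFirst-All : ∀ {p} {P : Carrier → Set p} {n} {c : Vector Carrier n} →
                     (∀ i → P (c i)) → All P (leadingFirst c)
  leadingFirst-All {n = zero}  Pc = []
  leadingFirst-All {n = suc n} Pc = Pc (fromℕ n) ∷ leadingFirst-All (Pc ∘ inject₁)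

  sum≈poly : ∀ {n} (c : Vector Carrier n) x → sum (λ i → c i ⊗ x ^ toℕ i) ≈ poly (leadingFirst c) x
  sum≈poly {zero}  c x = refl
  sum≈poly {suc n} c x = begin
    sum (λ i → c i ⊗ x ^ toℕ i)
      ≈⟨ sum-init-last (λ i → c i ⊗ x ^ toℕ i) ⟩
    sum (λ i → c (inject₁ i) ⊗ x ^ toℕ (inject₁ i)) ⊕ c (fromℕ n) ⊗ x ^ toℕ (fromℕ n)
      ≡⟨ ≡.cong₂ _⊕_ (sum-cong-≗ (λ i → ≡.cong (λ k → c (inject₁ i) ⊗ x ^ k) (toℕ-inject₁ i)))
                     (≡.cong (λ k → c (fromℕ n) ⊗ x ^ k) (toℕ-fromℕ n)) ⟩
    sum (λ i → c (inject₁ i) ⊗ x ^ toℕ i) ⊕ c (fromℕ n) ⊗ x ^ n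
      ≈⟨ ⊕-congʳ (sum≈poly (c ∘ inject₁) x) ⟩
    poly (leadingFirst (c ∘ inject₁)) x ⊕ c (fromℕ n) ⊗ x ^ n
      ≈⟨ ⊕-comm _ _ ⟩
    poly (leadingFirst c) x ∎

  record IsSubring (Δ : Carrier) : Set (a ⊔ ℓ) where
    field
      𝟏<Δ      : 𝟏 < Δ
      ⊕-closed : ∀ {x y} → x < Δ → y < Δ → x ⊕ y < Δ
      ⊗-closed : ∀ {x y} → x < Δ → y < Δ → x ⊗ y < Δ

  HasInverse : Carrier → Carrier → Set (a ⊔ ℓ)
  HasInverse Δ x = ∃[ y ] y < Δ × x ⊗ y ≈ 𝟏

  HasRoot : Carrier → ∀ {n} → Vec Carrier n → Set (a ⊔ ℓ)
  HasRoot Δ c = ∃[ x ] x < Δ × monic c x ≈ 𝟎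

  -- Simplest extensions of a subring Δ.

  module SimplestExtension {Δ : Carrier} (isSubring : IsSubring Δ) where
    open IsSubring isSubring

    𝟎<Δ : 𝟎 < Δ
    𝟎<Δ = trans 𝟎<𝟏 𝟏<Δ

    Δ≉𝟎 : ¬ Δ ≈ 𝟎
    Δ≉𝟎 Δ≈𝟎 = irrefl (sym Δ≈𝟎) 𝟎<Δ

    -- If 𝟏 < α ⊗ Δ, then 𝟏 is the option of α ⊗ Δ at some (α′ , δ).  For α′ ≈ 𝟎
    -- this makes δ an inverse of α; otherwise it can be solved for Δ within Δ.
    inverse : ∀ {α} → ¬ α ≈ 𝟎 → α < Δ → (∀ {α′} → α′ < α → ¬ α′ ≈ 𝟎 → HasInverse Δ α′) →
              HasInverse Δ α ⊎ α ⊗ Δ ≈ 𝟏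
    inverse {α} α≉𝟎 α<Δ inv with compare (α ⊗ Δ) 𝟏
    ... | tri< αΔ<𝟏 _ _ = contradiction (x<𝟏⇒x≈𝟎 αΔ<𝟏) (x⊗y≉𝟎 α≉𝟎 Δ≉𝟎)
    ... | tri≈ _ αΔ≈𝟏 _ = inj₂ αΔ≈𝟏
    ... | tri> _ _ 𝟏<αΔ with <-⊗ 𝟏<αΔ
    ...   | α′ , α′<α , δ , δ<Δ , eq with compare α′ 𝟎
    ...     | tri< α′<𝟎 _ _ = contradiction α′<𝟎 x≮𝟎
    ...     | tri≈ _ α′≈𝟎 _ = inj₁ (δ , δ<Δ , (begin
                α ⊗ δ
                  ≈⟨ solve 3 (λ α δ Δ → α :* δ := con false :* Δ :+ α :* δ :+ con false :* δ) refl α δ Δ ⟩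
                𝟎 ⊗ Δ ⊕ α ⊗ δ ⊕ 𝟎 ⊗ δ
                  ≈⟨ ⊕-cong (⊕-congʳ (⊗-congʳ α′≈𝟎)) (⊗-congʳ α′≈𝟎) ⟨
                α′ ⊗ Δ ⊕ α ⊗ δ ⊕ α′ ⊗ δ
                  ≈⟨ eq ⟨
                𝟏 ∎))
    ...     | tri> _ _ 𝟎<α′ with inv α′<α (λ α′≈𝟎 → irrefl (sym α′≈𝟎) 𝟎<α′)
    ...       | β , β<Δ , α′β≈𝟏 = contradiction
                (⊕-closed β<Δ (⊗-closed β<Δ (⊗-closed (⊕-closed α<Δ (trans α′<α α<Δ)) δ<Δ)))
                (irrefl (begin
                  β ⊕ β ⊗ ((α ⊕ α′) ⊗ δ)
                    ≈⟨ solve 4 (λ α α′ β δ → β :+ β :* ((α :+ α′) :* δ) :=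
                         con true :* β :+ β :* ((α :+ α′) :* δ)) refl α α′ β δ ⟩
                  𝟏 ⊗ β ⊕ β ⊗ ((α ⊕ α′) ⊗ δ)
                    ≈⟨ ⊕-congʳ (⊗-congʳ eq) ⟩
                  (α′ ⊗ Δ ⊕ α ⊗ δ ⊕ α′ ⊗ δ) ⊗ β ⊕ β ⊗ ((α ⊕ α′) ⊗ δ)
                    ≈⟨ solve 5 (λ α α′ β δ Δ →
                         (α′ :* Δ :+ α :* δ :+ α′ :* δ) :* β :+ β :* ((α :+ α′) :* δ) :=
                         α′ :* β :* Δ) refl α α′ β δ Δ ⟩
                  α′ ⊗ β ⊗ Δ
                    ≈⟨ ⊗-congʳ α′β≈𝟏 ⟩
                  𝟏 ⊗ Δ
                    ≈⟨ solve 1 (λ Δ → con true :* Δ := Δ) refl Δ ⟩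
                  Δ ∎))

    -- Synthetic division by `x ⊕ r`. The leading coefficient `u` is kept apart from `c` because the
    -- recursion replaces it by the carry `u ⊗ r ⊕ b`.
    divide : ∀ {r} → r < Δ → ∀ {n u} {c : Vec Carrier n} → u < Δ → All (_< Δ) c →
             ∃[ q ] All (_< Δ) q × ∀ x →
               u ⊗ x ^ n ⊕ poly c x ≈ (x ⊕ r) ⊗ poly {n} q x ⊕ (u ⊗ r ^ n ⊕ poly c r)
    divide {r} r<Δ {u = u} u<Δ [] = [] , [] , λ x →
      solve 3 (λ u r x → u :* con true :+ con false :=
        (x :+ r) :* con false :+ (u :* con true :+ con false)) refl u r x
    divide {r} r<Δ {suc n} {u} {b ∷ c} u<Δ (b<Δ ∷ c<Δ)
      with q , q<Δ , eq ← divide r<Δ (⊕-closed (⊗-closed u<Δ r<Δ) b<Δ) c<Δ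
      = u ∷ q , u<Δ ∷ q<Δ , λ x → begin
      u ⊗ (x ⊗ x ^ n) ⊕ (b ⊗ x ^ n ⊕ poly c x)
        ≈⟨ solve 6 (λ u x b r X p → u :* (x :* X) :+ (b :* X :+ p) :=
             (x :+ r) :* (u :* X) :+ ((u :* r :+ b) :* X :+ p)) refl u x b r (x ^ n) (poly c x) ⟩
      (x ⊕ r) ⊗ (u ⊗ x ^ n) ⊕ ((u ⊗ r ⊕ b) ⊗ x ^ n ⊕ poly c x)
        ≈⟨ ⊕-congˡ (eq x) ⟩
      (x ⊕ r) ⊗ (u ⊗ x ^ n) ⊕ ((x ⊕ r) ⊗ poly q x ⊕ ((u ⊗ r ⊕ b) ⊗ r ^ n ⊕ poly c r))
        ≈⟨ solve 8 (λ u x b r X q R p →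
             (x :+ r) :* (u :* X) :+ ((x :+ r) :* q :+ ((u :* r :+ b) :* R :+ p)) :=
             (x :+ r) :* (u :* X :+ q) :+ (u :* (r :* R) :+ (b :* R :+ p))) refl
             u x b r (x ^ n) (poly q x) (r ^ n) (poly c r) ⟩
      (x ⊕ r) ⊗ (u ⊗ x ^ n ⊕ poly q x) ⊕ (u ⊗ (r ⊗ r ^ n) ⊕ (b ⊗ r ^ n ⊕ poly c r)) ∎

    factorRoot : ∀ {n} {c : Vec Carrier (suc n)} → All (_< Δ) c → HasRoot Δ c →
                 ∃[ r ] r < Δ × ∃[ q ] All (_< Δ) q × ∀ x → monic c x ≈ (x ⊕ r) ⊗ monic {n} q x
    factorRoot {n} {b ∷ c} (b<Δ ∷ c<Δ) (r , r<Δ , root)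
      -- The implicit leading coefficient 1 makes the first carry `r ⊕ b`.
      with q , q<Δ , eq ← divide r<Δ (⊕-closed r<Δ b<Δ) c<Δ
      = r , r<Δ , q , q<Δ , λ x → begin
      x ⊗ x ^ n ⊕ (b ⊗ x ^ n ⊕ poly c x)
        ≈⟨ solve 5 (λ x b r X p → x :* X :+ (b :* X :+ p) :=
             (x :+ r) :* X :+ ((r :+ b) :* X :+ p)) refl x b r (x ^ n) (poly c x) ⟩
      (x ⊕ r) ⊗ x ^ n ⊕ ((r ⊕ b) ⊗ x ^ n ⊕ poly c x)
        ≈⟨ ⊕-congˡ (eq x) ⟩
      (x ⊕ r) ⊗ x ^ n ⊕ ((x ⊕ r) ⊗ poly q x ⊕ ((r ⊕ b) ⊗ r ^ n ⊕ poly c r))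
        ≈⟨ solve 7 (λ x b r X q R p →
             (x :+ r) :* X :+ ((x :+ r) :* q :+ ((r :+ b) :* R :+ p)) :=
             (x :+ r) :* (X :+ q) :+ (r :* R :+ (b :* R :+ p))) refl
             x b r (x ^ n) (poly q x) (r ^ n) (poly c r) ⟩
      (x ⊕ r) ⊗ monic q x ⊕ monic (b ∷ c) r
        ≈⟨ ⊕-congˡ root ⟩
      (x ⊕ r) ⊗ monic q x ⊕ 𝟎
        ≈⟨ ⊕-identityʳ _ ⟩
      (x ⊕ r) ⊗ monic q x ∎

    multiplyRoot : ∀ {r} → r < Δ → ∀ {n u} {q : Vec Carrier n} → u < Δ → All (_< Δ) q →
                   ∃[ c ] All (_< Δ) c × ∀ x →
                     (x ⊕ r) ⊗ (u ⊗ x ^ n ⊕ poly q x) ≈ u ⊗ x ^ suc n ⊕ poly {suc n} c x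
    multiplyRoot {r} r<Δ {u = u} u<Δ [] = r ⊗ u ∷ [] , ⊗-closed r<Δ u<Δ ∷ [] , λ x →
      solve 3 (λ u r x → (x :+ r) :* (u :* con true :+ con false) :=
        u :* (x :* con true) :+ (r :* u :* con true :+ con false)) refl u r x
    multiplyRoot {r} r<Δ {suc n} {u} {b ∷ q} u<Δ (b<Δ ∷ q<Δ)
      with c , c<Δ , eq ← multiplyRoot r<Δ b<Δ q<Δ
      = r ⊗ u ⊕ b ∷ c , ⊕-closed (⊗-closed r<Δ u<Δ) b<Δ ∷ c<Δ , λ x → begin
      (x ⊕ r) ⊗ (u ⊗ (x ⊗ x ^ n) ⊕ (b ⊗ x ^ n ⊕ poly q x))
        ≈⟨ solve 4 (λ x r u q → (x :+ r) :* (u :+ q) := (x :+ r) :* u :+ (x :+ r) :* q) refl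
             x r (u ⊗ x ^ suc n) (b ⊗ x ^ n ⊕ poly q x) ⟩
      (x ⊕ r) ⊗ (u ⊗ (x ⊗ x ^ n)) ⊕ (x ⊕ r) ⊗ (b ⊗ x ^ n ⊕ poly q x)
        ≈⟨ ⊕-congˡ (eq x) ⟩
      (x ⊕ r) ⊗ (u ⊗ (x ⊗ x ^ n)) ⊕ (b ⊗ (x ⊗ x ^ n) ⊕ poly c x)
        ≈⟨ solve 6 (λ x r u b X p → (x :+ r) :* (u :* (x :* X)) :+ (b :* (x :* X) :+ p) :=
             u :* (x :* (x :* X)) :+ ((r :* u :+ b) :* (x :* X) :+ p)) refl x r u b (x ^ n) (poly c x) ⟩
      u ⊗ (x ⊗ (x ⊗ x ^ n)) ⊕ ((r ⊗ u ⊕ b) ⊗ (x ⊗ x ^ n) ⊕ poly c x) ∎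

    -- The option of `Δ ⊗ Δ ^ n` at `δ` and `Γ` equals `Δ ^ suc n ⊕ (Δ ⊕ δ) ⊗ (Δ ^ n ⊕ Γ)`. With `Γ`
    -- written as a polynomial in `Δ`, the product becomes the value at `Δ` of a monic polynomial
    -- with root `δ`, and `Δ ^ suc n` cancels its leading term.
    <-^-step : ∀ {n} → (∀ {γ} → γ < Δ ^ n → ∃[ q ] All (_< Δ) q × γ ≈ poly {n} q Δ) →
               ∀ {γ} → γ < Δ ^ suc n →
               ∃[ c ] All (_< Δ) c × γ ≈ poly {suc n} c Δ × HasRoot Δ c
    <-^-step {n} ih {γ} γ<
      with δ , δ<Δ , Γ , Γ< , γ≈ ← <-⊗ γ<
      with q , q<Δ , Γ≈ ← ih Γ<
      with c , c<Δ , eq ← multiplyRoot δ<Δ 𝟏<Δ q<Δ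
      = c , c<Δ
      , (begin
        γ
          ≈⟨ γ≈ ⟩
        δ ⊗ Δ ^ n ⊕ Δ ⊗ Γ ⊕ δ ⊗ Γ
          ≈⟨ ⊕-cong (⊕-congˡ (⊗-congˡ Γ≈)) (⊗-congˡ Γ≈) ⟩
        δ ⊗ Δ ^ n ⊕ Δ ⊗ poly q Δ ⊕ δ ⊗ poly q Δ
          ≈⟨ solve 4 (λ δ Δ X q → δ :* X :+ Δ :* q :+ δ :* q :=
               (Δ :+ δ) :* (con true :* X :+ q) :+ Δ :* X) refl δ Δ (Δ ^ n) (poly q Δ) ⟩
        (Δ ⊕ δ) ⊗ (𝟏 ⊗ Δ ^ n ⊕ poly q Δ) ⊕ Δ ⊗ Δ ^ n
          ≈⟨ ⊕-congʳ (eq Δ) ⟩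
        𝟏 ⊗ Δ ^ suc n ⊕ poly c Δ ⊕ Δ ^ suc n
          ≈⟨ solve 2 (λ X p → con true :* X :+ p :+ X := p) refl (Δ ^ suc n) (poly c Δ) ⟩
        poly c Δ ∎)
      , δ , δ<Δ , (begin
        δ ^ suc n ⊕ poly c δ
          ≈⟨ solve 2 (λ X p → X :+ p := con true :* X :+ p) refl (δ ^ suc n) (poly c δ) ⟩
        𝟏 ⊗ δ ^ suc n ⊕ poly c δ
          ≈⟨ eq δ ⟨
        (δ ⊕ δ) ⊗ (𝟏 ⊗ δ ^ n ⊕ poly q δ)
          ≈⟨ solve 2 (λ δ p → (δ :+ δ) :* p := con false) refl δ (𝟏 ⊗ δ ^ n ⊕ poly q δ) ⟩
        𝟎 ∎)

    <-^ : ∀ n {γ} → γ < Δ ^ n → ∃[ c ] All (_< Δ) c × γ ≈ poly {n} c Δ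
    <-^ zero    γ<𝟏 = [] , [] , x<𝟏⇒x≈𝟎 γ<𝟏
    <-^ (suc n) γ< = let c , c<Δ , γ≈ , _ = <-^-step (<-^ n) γ< in c , c<Δ , γ≈

    scale : ∀ {s n} {c : Vec Carrier n} → s < Δ → All (_< Δ) c → All (_< Δ) (map (s ⊗_) c)
    scale s<Δ []          = []
    scale s<Δ (a<Δ ∷ c<Δ) = ⊗-closed s<Δ a<Δ ∷ scale s<Δ c<Δ

    add : ∀ {n} {c d : Vec Carrier n} → All (_< Δ) c → All (_< Δ) d → All (_< Δ) (zipWith _⊕_ c d)
    add []          []          = []
    add (a<Δ ∷ c<Δ) (b<Δ ∷ d<Δ) = ⊕-closed a<Δ b<Δ ∷ add c<Δ d<Δ

    -- Multiplying by the inverse `t` of the leading coefficient `b` makes the polynomial monic, and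
    -- multiplying back by `b` shows that the root is kept.
    monicRoot⇒root : (∀ {x} → x < Δ → ¬ x ≈ 𝟎 → HasInverse Δ x) →
                     (∀ {n} {c : Vec Carrier (suc n)} → All (_< Δ) c → HasRoot Δ c) →
                     ∀ d (c : Vector Carrier (suc (suc d))) → (∀ i → c i < Δ) → ¬ c (fromℕ (suc d)) ≈ 𝟎 →
                     ∃[ x ] x < Δ × sum (λ i → c i ⊗ x ^ toℕ i) ≈ 𝟎
    monicRoot⇒root inv root d c c<Δ lead≉𝟎 =
      let b = c (fromℕ (suc d))
          e = leadingFirst (c ∘ inject₁)
          t , t<Δ , bt≈𝟏 = inv (c<Δ (fromℕ (suc d))) lead≉𝟎
          x , x<Δ , te[x]≈𝟎 = root (scale t<Δ (leadingFirst-All (c<Δ ∘ inject₁)))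
          X = x ^ suc d
      in x , x<Δ , (begin
        sum (λ i → c i ⊗ x ^ toℕ i)
          ≈⟨ sum≈poly c x ⟩
        b ⊗ X ⊕ poly e x
          ≈⟨ solve 3 (λ b X p → b :* X :+ p := b :* X :+ con true :* p) refl b X (poly e x) ⟩
        b ⊗ X ⊕ 𝟏 ⊗ poly e x
          ≈⟨ ⊕-congˡ (⊗-congʳ bt≈𝟏) ⟨
        b ⊗ X ⊕ b ⊗ t ⊗ poly e x
          ≈⟨ solve 4 (λ b t X p → b :* X :+ b :* t :* p := b :* (X :+ t :* p)) refl b t X (poly e x) ⟩
        b ⊗ (X ⊕ t ⊗ poly e x)
          ≈⟨ ⊗-congˡ (⊕-congˡ (poly-⊗ t e x)) ⟨
        b ⊗ monic (map (t ⊗_) e) x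
          ≈⟨ ⊗-congˡ te[x]≈𝟎 ⟩
        b ⊗ 𝟎
          ≈⟨ ⊗-zeroʳ b ⟩
        𝟎 ∎)

    -- An option of a sum changes one summand. Lowering the tail keeps `b`, and the induction
    -- applies. Lowering `b ⊗ Δ ^ n` replaces `b` by a smaller `b′` and adds `(b ⊕ b′) ⊗ Γ` with
    -- `Γ < Δ ^ n`, which by `<-^` affects only later coefficients.
    <-poly : ∀ {n} {g : Vec Carrier n} → All (_< Δ) g → ∀ {γ} → γ < poly g Δ →
             ∃[ h ] All (_< Δ) h × Lex-< _≈_ _<_ h g × γ ≈ poly {n} h Δ
    <-poly []                          γ<  = contradiction γ< x≮𝟎
    <-poly {suc n} {b ∷ g} (b<Δ ∷ g<Δ) {γ} γ< with <-⊕ γ<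
    ... | inj₂ (γ′ , γ′< , γ≈)
      with h , h<Δ , h<g , γ′≈ ← <-poly g<Δ γ′<
      = b ∷ h , b<Δ ∷ h<Δ , next refl h<g , ≈-trans γ≈ (⊕-congˡ γ′≈)
    ... | inj₁ (γ′ , γ′< , γ≈)
      with b′ , b′<b , Γ , Γ< , γ′≈ ← <-⊗ γ′<
      with e , e<Δ , Γ≈ ← <-^ n Γ<
      = b′ ∷ zipWith _⊕_ (map ((b ⊕ b′) ⊗_) e) g
      , b′<Δ ∷ add (scale (⊕-closed b<Δ b′<Δ) e<Δ) g<Δ
      , this b′<b ≡.refl
      , (begin
        γ
          ≈⟨ γ≈ ⟩
        γ′ ⊕ poly g Δ
          ≈⟨ ⊕-congʳ γ′≈ ⟩
        b′ ⊗ Δ ^ n ⊕ b ⊗ Γ ⊕ b′ ⊗ Γ ⊕ poly g Δ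
          ≈⟨ ⊕-congʳ (⊕-cong (⊕-congˡ (⊗-congˡ Γ≈)) (⊗-congˡ Γ≈)) ⟩
        b′ ⊗ Δ ^ n ⊕ b ⊗ poly e Δ ⊕ b′ ⊗ poly e Δ ⊕ poly g Δ
          ≈⟨ solve 5 (λ b b′ X e g → b′ :* X :+ b :* e :+ b′ :* e :+ g :=
               b′ :* X :+ ((b :+ b′) :* e :+ g)) refl b b′ (Δ ^ n) (poly e Δ) (poly g Δ) ⟩
        b′ ⊗ Δ ^ n ⊕ ((b ⊕ b′) ⊗ poly e Δ ⊕ poly g Δ)
          ≈⟨ ⊕-congˡ (⊕-congʳ (poly-⊗ (b ⊕ b′) e Δ)) ⟨
        b′ ⊗ Δ ^ n ⊕ (poly (map ((b ⊕ b′) ⊗_) e) Δ ⊕ poly g Δ)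
          ≈⟨ ⊕-congˡ (poly-⊕ (map ((b ⊕ b′) ⊗_) e) g Δ) ⟨
        b′ ⊗ Δ ^ n ⊕ poly (zipWith _⊕_ (map ((b ⊕ b′) ⊗_) e) g) Δ ∎)
      where
      b′<Δ = trans b′<b b<Δ

    module _ {n : ℕ}
             (inv  : ∀ {x} → x < Δ → ¬ x ≈ 𝟎 → HasInverse Δ x)
             (root : ∀ {k} → k ℕ.< n → {c : Vec Carrier (suc k)} → All (_< Δ) c → HasRoot Δ c)
             where

      -- After splitting off the root `r`, neither factor vanishes at `Δ`: `r` lies below `Δ`, and
      -- the quotient is covered by the hypothesis.
      hasRoot⇒monic≉𝟎 : ∀ {k} {c : Vec Carrier (suc k)} → All (_< Δ) c → HasRoot Δ c →
                         (∀ {q : Vec Carrier k} → All (_< Δ) q → ¬ monic q Δ ≈ 𝟎) → ¬ monic c Δ ≈ 𝟎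
      hasRoot⇒monic≉𝟎 c<Δ rt q≉𝟎 c≈𝟎 with r , r<Δ , q , q<Δ , eq ← factorRoot c<Δ rt =
        x⊗y≉𝟎 (λ Δ⊕r≈𝟎 → irrefl (sym (⊕≈𝟎⇒≈ Δ⊕r≈𝟎)) r<Δ) (q≉𝟎 q<Δ) (≈-trans (sym (eq Δ)) c≈𝟎)

      -- Up to degree `n`, monic polynomials split into linear factors over `Δ`, whose roots differ
      -- from `Δ`.
      monic≉𝟎 : ∀ {k} → k ℕ.≤ n → {c : Vec Carrier k} → All (_< Δ) c → ¬ monic c Δ ≈ 𝟎
      monic≉𝟎 {zero}  _   [] 𝟏⊕𝟎≈𝟎 = irrefl (sym (⊕≈𝟎⇒≈ 𝟏⊕𝟎≈𝟎)) 𝟎<𝟏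
      monic≉𝟎 {suc k} k<n c<Δ =
        hasRoot⇒monic≉𝟎 c<Δ (root k<n c<Δ) (monic≉𝟎 (ℕ.<⇒≤ k<n))

      -- If the leading coefficients differed, dividing the difference of the polynomials by theirs
      -- would give a monic polynomial of degree at most `n` with root `Δ`.
      poly-injective : ∀ {k} → k ℕ.≤ suc n → {c d : Vec Carrier k} → All (_< Δ) c → All (_< Δ) d →
                       poly c Δ ≈ poly d Δ → Pointwise _≈_ c d
      poly-injective _ [] [] _ = []
      poly-injective {suc k} k<1+n {b ∷ c} {b′ ∷ d} (b<Δ ∷ c<Δ) (b′<Δ ∷ d<Δ) eq =
        b≈b′ ∷ poly-injective (ℕ.<⇒≤ k<1+n) c<Δ d<Δ
          (⊕-cancelˡ (≈-trans eq (⊕-congʳ (⊗-congʳ (sym b≈b′)))))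
        where
        s = b ⊕ b′
        s≈𝟎 : ¬ ¬ s ≈ 𝟎
        s≈𝟎 s≉𝟎 with t , t<Δ , st≈𝟏 ← inv (⊕-closed b<Δ b′<Δ) s≉𝟎 =
          monic≉𝟎 (ℕ.≤-pred k<1+n) (scale t<Δ (add c<Δ d<Δ)) (begin
            Δ ^ k ⊕ poly (map (t ⊗_) (zipWith _⊕_ c d)) Δ
              ≈⟨ ⊕-congˡ (≈-trans (poly-⊗ t (zipWith _⊕_ c d) Δ) (⊗-congˡ (poly-⊕ c d Δ))) ⟩
            Δ ^ k ⊕ t ⊗ (poly c Δ ⊕ poly d Δ)
              ≈⟨ solve 4 (λ X t p q → X :+ t :* (p :+ q) := con true :* X :+ t :* (p :+ q)) refl
                   (Δ ^ k) t (poly c Δ) (poly d Δ) ⟩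
            𝟏 ⊗ Δ ^ k ⊕ t ⊗ (poly c Δ ⊕ poly d Δ)
              ≈⟨ ⊕-congʳ (⊗-congʳ st≈𝟏) ⟨
            s ⊗ t ⊗ Δ ^ k ⊕ t ⊗ (poly c Δ ⊕ poly d Δ)
              ≈⟨ solve 6 (λ b b′ X t p q → (b :+ b′) :* t :* X :+ t :* (p :+ q) :=
                   t :* ((b :* X :+ p) :+ (b′ :* X :+ q))) refl b b′ (Δ ^ k) t (poly c Δ) (poly d Δ) ⟩
            t ⊗ (poly (b ∷ c) Δ ⊕ poly (b′ ∷ d) Δ)
              ≈⟨ ⊗-congˡ (≈⇒⊕≈𝟎 eq) ⟩
            t ⊗ 𝟎
              ≈⟨ ⊗-zeroʳ t ⟩
            𝟎 ∎)
        b≈b′ : b ≈ b′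
        b≈b′ = ≮⇒≈ (λ b<b′ → s≈𝟎 (λ s≈𝟎 → irrefl (⊕≈𝟎⇒≈ s≈𝟎) b<b′))
                   (λ b′<b → s≈𝟎 (λ s≈𝟎 → irrefl (sym (⊕≈𝟎⇒≈ s≈𝟎)) b′<b))

      -- If g(Δ) < Δ ^ suc n, then g has the coefficients of a monic polynomial with
      -- a root in Δ; if g(Δ) > Δ ^ suc n, then Δ is a root of an earlier polynomial.
      monicRoot : {g : Vec Carrier (suc n)} → All (_< Δ) g →
                  ({h : Vec Carrier (suc n)} → All (_< Δ) h → Lex-< _≈_ _<_ h g → HasRoot Δ h) →
                  HasRoot Δ g ⊎ monic g Δ ≈ 𝟎
      monicRoot {g} g<Δ earlier with compare (poly g Δ) (Δ ^ suc n)
      ... | tri≈ _ eq _ = inj₂ (≈⇒⊕≈𝟎 (sym eq))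
      ... | tri< g<Δ^n _ _ =
        let c , c<Δ , g≈c , δ , δ<Δ , c[δ]≈𝟎 = <-^-step (<-^ n) g<Δ^n
            g≋c = poly-injective ℕ.≤-refl g<Δ c<Δ g≈c
        in inj₁ (δ , δ<Δ , ≈-trans (monic-cong g≋c refl) c[δ]≈𝟎)
      ... | tri> _ _ Δ^n<g =
        let h , h<Δ , h<g , Δ^n≈h = <-poly g<Δ Δ^n<g
        in contradiction (≈⇒⊕≈𝟎 Δ^n≈h)
             (hasRoot⇒monic≉𝟎 h<Δ (earlier h<Δ h<g) (monic≉𝟎 ℕ.≤-refl))

-- Closing off below a regular ordinal Ω.

module Closure {a ℓ : Level} (N : NimArithmetic a ℓ) where
  open NimArithmetic N
  open NimRing N
  open NimPolynomial N
  open Eq using (refl; sym) renaming (trans to ≈-trans)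

  -- Regularity in the form in which ω₁ has it. The enumeration `g` may take values outside `γ`; the
  -- last component of `supremum` makes `s` the least strict upper bound.
  record IsRegular (Ω : Carrier) : Set (a ⊔ ℓ) where
    field
      𝟏<Ω       : 𝟏 < Ω
      enumerate : ∀ {γ} → γ < Ω → Σ[ g ∈ (ℕ → Carrier) ] (∀ {β} → β < γ → ∃[ n ] β ≈ g n)
      supremum  : ∀ {f : ℕ → Carrier} → (∀ n → f n < Ω) →
                  ∃[ s ] s < Ω × (∀ n → f n < s) × (∀ {y} → y < s → ∃[ n ] ¬ f n < y)

  module Regular {Ω : Carrier} (isRegular : IsRegular Ω) where
    open IsRegular isRegular

    𝟎<Ω : 𝟎 < Ω
    𝟎<Ω = trans 𝟎<𝟏 𝟏<Ω

    module _ {r : Level} {R : Carrier → Carrier → Set r}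
             (R-respˡ : ∀ {α α′ y} → α ≈ α′ → R α y → R α′ y) where

      -- Values chosen along a countable enumeration of `γ` have a supremum below `Ω`. A relation
      -- replaces a function because chosen values need not respect `_≈_`.
      bound : ∀ {γ} → γ < Ω → (∀ {α} → α < γ → ∃[ y ] y < Ω × R α y) →
              ∃[ δ ] δ < Ω × ∀ {α} → α < γ → ∃[ y ] y < δ × R α y
      bound {γ} γ<Ω total = s , s<Ω , bounded
        where
        g = proj₁ (enumerate γ<Ω)
        value : ∀ α → Dec (α < γ) → ∃[ y ] y < Ω × (α < γ → R α y)
        value α (yes α<γ) = let y , y<Ω , Rαy = total α<γ in y , y<Ω , λ _ → Rαy
        -- Indices at which the enumeration leaves `γ` contribute the harmless value `𝟎`.
        value α (no α≮γ)  = 𝟎 , 𝟎<Ω , λ α<γ → contradiction α<γ α≮γ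
        v : ∀ n → ∃[ y ] y < Ω × (g n < γ → R (g n) y)
        v n = value (g n) (g n <? γ)
        sup = supremum (λ n → proj₁ (proj₂ (v n)))
        s = proj₁ sup
        s<Ω = proj₁ (proj₂ sup)
        bounded : ∀ {α} → α < γ → ∃[ y ] y < s × R α y
        bounded α<γ =
          let n , α≈ = proj₂ (enumerate γ<Ω) α<γ
              y , _ , Ry = v n
          in y , proj₁ (proj₂ (proj₂ sup)) n , R-respˡ (sym α≈) (Ry (<-respˡ-≈ α≈ α<γ))

    -- Induction on the arity: for a fixed first component, bounding all tails is itself a relation
    -- to which `bound` applies.
    boundVec : ∀ {r k} {R : Vec Carrier k → Carrier → Set r} →
               (∀ {v w y} → Pointwise _≈_ v w → R v y → R w y) →
               ∀ {γ} → γ < Ω → (∀ {v} → All (_< γ) v → ∃[ y ] y < Ω × R v y) →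
               ∃[ δ ] δ < Ω × ∀ {v} → All (_< γ) v → ∃[ y ] y < δ × R v y
    boundVec {k = zero} R-resp γ<Ω total =
      let y , y<Ω , Ry = total []
          s , s<Ω , f<s , _ = supremum {λ _ → y} (λ _ → y<Ω)
      in s , s<Ω , λ { [] → y , f<s 0 , Ry }
    boundVec {k = suc k} {R} R-resp {γ} γ<Ω total =
      let δ , δ<Ω , h = bound {R = λ α δ → ∀ {v} → All (_< γ) v → ∃[ y ] y < δ × R (α ∷ v) y}
                          (λ α≈α′ f v<γ → let y , y<δ , Ry = f v<γ
                                          in y , y<δ , R-resp (α≈α′ ∷ Pointwise.refl refl) Ry)
                          γ<Ω
                          (λ α<γ → boundVec (λ v≋w → R-resp (refl ∷ v≋w)) γ<Ω
                                            (λ v<γ → total (α<γ ∷ v<γ)))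
      in δ , δ<Ω , λ { (α<γ ∷ v<γ) → let ε , ε<δ , f = h α<γ
                                         y , y<ε , Ry = f v<γ
                                     in y , trans y<ε ε<δ , Ry }

    -- A strict upper bound of all options is not an option, so the mex does not exceed it; by
    -- induction the options have such a bound below `Ω`.
    ⊕-<Ω : ∀ {x y} → x < Ω → y < Ω → x ⊕ y < Ω
    ⊕-<Ω {x} {y} = go x y (<-wellFounded x) (<-wellFounded y)
      where
      go : ∀ x y → Acc _<_ x → Acc _<_ y → x < Ω → y < Ω → x ⊕ y < Ω
      go x y (acc rx) (acc ry) x<Ω y<Ω
        with s , s<Ω , hs ← bound {R = λ x′ z → z ≈ x′ ⊕ y}
               (λ x′≈ z≈ → ≈-trans z≈ (⊕-congʳ x′≈)) x<Ω
               (λ {x′} x′<x → x′ ⊕ y , go x′ y (rx x′<x) (acc ry) (trans x′<x x<Ω) y<Ω , refl)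
        with t , t<Ω , ht ← bound {R = λ y′ z → z ≈ x ⊕ y′}
               (λ y′≈ z≈ → ≈-trans z≈ (⊕-congˡ y′≈)) y<Ω
               (λ {y′} y′<y → x ⊕ y′ , go x y′ (acc rx) (ry y′<y) x<Ω (trans y′<y y<Ω) , refl)
        -- The sequence s, t, t, ... makes the countable supremum a common bound of two ordinals.
        with u , u<Ω , s,t<u , _ ← supremum {λ { zero → s ; (suc _) → t }}
               (λ { zero → s<Ω ; (suc _) → t<Ω })
        with compare (x ⊕ y) u
      ... | tri< lt _ _ = trans lt u<Ω
      ... | tri≈ _ eq _ = <-respˡ-≈ (sym eq) u<Ω
      ... | tri> _ _ gt with <-⊕ gt
      ...   | inj₁ (_ , x′<x , u≈) = let z , z<s , z≈ = hs x′<x in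
              contradiction (trans z<s (s,t<u 0)) (irrefl (≈-trans z≈ (sym u≈)))
      ...   | inj₂ (_ , y′<y , u≈) = let z , z<t , z≈ = ht y′<y in
              contradiction (trans z<t (s,t<u 1)) (irrefl (≈-trans z≈ (sym u≈)))

    ⊗-<Ω : ∀ {x y} → x < Ω → y < Ω → x ⊗ y < Ω
    ⊗-<Ω {x} {y} = go x y (<-wellFounded x) (<-wellFounded y)
      where
      go : ∀ x y → Acc _<_ x → Acc _<_ y → x < Ω → y < Ω → x ⊗ y < Ω
      go x y (acc rx) (acc ry) x<Ω y<Ω
        -- Product options depend on two arguments: the bounds over `y′` are in turn bounded over
        -- `x′`.
        with s , s<Ω , hs ← bound
               {R = λ x′ δ → ∀ {y′} → y′ < y → ∃[ z ] z < δ × z ≈ x′ ⊗ y ⊕ x ⊗ y′ ⊕ x′ ⊗ y′}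
               (λ x′≈ h y′<y → let z , z<δ , z≈ = h y′<y in
                  z , z<δ , ≈-trans z≈ (⊕-cong (⊕-congʳ (⊗-congʳ x′≈)) (⊗-congʳ x′≈)))
               x<Ω
               (λ {x′} x′<x → bound {R = λ y′ z → z ≈ x′ ⊗ y ⊕ x ⊗ y′ ⊕ x′ ⊗ y′}
                  (λ y′≈ z≈ → ≈-trans z≈ (⊕-cong (⊕-congˡ (⊗-congˡ y′≈)) (⊗-congˡ y′≈)))
                  y<Ω
                  (λ {y′} y′<y → let x′<Ω = trans x′<x x<Ω ; y′<Ω = trans y′<y y<Ω in
                    x′ ⊗ y ⊕ x ⊗ y′ ⊕ x′ ⊗ y′
                    , ⊕-<Ω (⊕-<Ω (go x′ y (rx x′<x) (acc ry) x′<Ω y<Ω)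
                                 (go x y′ (acc rx) (ry y′<y) x<Ω y′<Ω))
                           (go x′ y′ (rx x′<x) (ry y′<y) x′<Ω y′<Ω)
                    , refl))
        with compare (x ⊗ y) s
      ... | tri< lt _ _ = trans lt s<Ω
      ... | tri≈ _ eq _ = <-respˡ-≈ (sym eq) s<Ω
      ... | tri> _ _ gt =
        let x′ , x′<x , y′ , y′<y , s≈ = <-⊗ gt
            δ , δ<s , h = hs x′<x
            z , z<δ , z≈ = h y′<y
        in contradiction (trans z<δ δ<s) (irrefl (≈-trans z≈ (sym s≈)))

    -- The downward Löwenheim–Skolem argument, for countably many relations.
    module _ {r : Level} (arity : ℕ → ℕ) (R : ∀ i → Vec Carrier (arity i) → Carrier → Set r)
             (R-resp : ∀ i {v w y} → Pointwise _≈_ v w → R i v y → R i w y)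
             (total : ∀ i {v} → All (_< Ω) v → ∃[ y ] y < Ω × R i v y) where

      private
        below : ∀ {γ} → γ < Ω → ∀ {k} {v : Vec Carrier k} → All (_< γ) v → All (_< Ω) v
        below γ<Ω = All.map (λ x<γ → trans x<γ γ<Ω)

        values : ∀ {γ} → γ < Ω → ∀ i → ∃[ δ ] δ < Ω × ∀ {v} → All (_< γ) v → ∃[ y ] y < δ × R i v y
        values γ<Ω i = boundVec (R-resp i) γ<Ω (λ v<γ → total i (below γ<Ω v<γ))

        nextStage : ∀ {γ} → γ < Ω →
               ∃[ δ ] δ < Ω × γ < δ × ∀ i {v} → All (_< γ) v → ∃[ y ] y < δ × R i v y
        nextStage {γ} γ<Ω =
          let δ , δ<Ω , f<δ , _ = supremum bounds<Ω
          in δ , δ<Ω , f<δ 0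
             , λ i v<γ → let y , y<f , Ry = proj₂ (proj₂ (values γ<Ω i)) v<γ
                         in y , trans y<f (f<δ (suc i)) , Ry
          where
          bounds : ℕ → Carrier
          bounds zero    = γ
          bounds (suc i) = proj₁ (values γ<Ω i)
          bounds<Ω : ∀ n → bounds n < Ω
          bounds<Ω zero    = γ<Ω
          bounds<Ω (suc i) = proj₁ (proj₂ (values γ<Ω i))

      closingOff : ∀ {β} → β < Ω →
                   ∃[ Δ ] Δ < Ω × β < Δ × ∀ i {v} → All (_< Δ) v → ∃[ y ] y < Δ × R i v y
      closingOff {β} β<Ω = proj₁ sup , proj₁ (proj₂ sup) , chain<Δ 0 , closed
        where
        chain : ℕ → ∃[ γ ] γ < Ω
        chain zero    = β , β<Ω
        chain (suc n) = let δ , δ<Ω , _ = nextStage (proj₂ (chain n)) in δ , δ<Ω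
        γ : ℕ → Carrier
        γ n = proj₁ (chain n)
        sup = supremum {γ} (λ n → proj₂ (chain n))
        chain<Δ = proj₁ (proj₂ (proj₂ sup))
        γ-step : ∀ n → γ n < γ (suc n)
        γ-step n = proj₁ (proj₂ (proj₂ (nextStage (proj₂ (chain n)))))
        γ-mono : ∀ {m n} → m ℕ.≤′ n → ∀ {x} → x < γ m → x < γ n
        γ-mono ℕ.≤′-refl                x<γ = x<γ
        γ-mono {n = suc n} (ℕ.≤′-step m≤′n) x<γ = trans (γ-mono m≤′n x<γ) (γ-step n)
        stage : ∀ {x} → x < proj₁ sup → ∃[ n ] x < γ n
        stage {x} x<Δ with n , γn≮x ← proj₂ (proj₂ (proj₂ sup)) x<Δ with compare x (γ n)
        ... | tri< x<γn _ _ = n , x<γn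
        ... | tri≈ _ x≈γn _ = suc n , <-respˡ-≈ (sym x≈γn) (γ-step n)
        ... | tri> _ _ γn<x = contradiction γn<x γn≮x
        -- Arities are finite, so the largest of the stages found for the components contains the
        -- whole tuple; a related value then appears one stage later.
        stages : ∀ {k} {v : Vec Carrier k} → All (_< proj₁ sup) v → ∃[ n ] All (_< γ n) v
        stages []          = 0 , []
        stages (x<Δ ∷ v<Δ) =
          let m , x<γm = stage x<Δ
              n , v<γn = stages v<Δ
          in m ℕ.⊔ n , γ-mono (ℕ.≤⇒≤′ (ℕ.m≤m⊔n m n)) x<γm
                     ∷ All.map (γ-mono (ℕ.≤⇒≤′ (ℕ.m≤n⊔m m n))) v<γn
        closed : ∀ i {v} → All (_< proj₁ sup) v → ∃[ y ] y < proj₁ sup × R i v y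
        closed i v<Δ =
          let n , v<γn = stages v<Δ
              y , y<γ , Ry = proj₂ (proj₂ (proj₂ (nextStage (proj₂ (chain n))))) i v<γn
          in y , trans y<γ (chain<Δ (suc n)) , Ry

    module _ (P : Carrier → Set (a ⊔ ℓ)) (P? : ∀ x → Dec (P x)) (P-resp : ∀ {x y} → x ≈ y → P y → P x)
             (Q : ∀ {n} → Vec Carrier (suc n) → Set (a ⊔ ℓ)) (Q? : ∀ {n} (c : Vec Carrier (suc n)) → Dec (Q c))
             (Q-resp : ∀ {n} {c d : Vec Carrier (suc n)} → Pointwise _≈_ c d → Q d → Q c)
             (inv : ∀ {x} → x < Ω → P x → ¬ x ≈ 𝟎 → HasInverse Ω x)
             (root : ∀ {n} {c : Vec Carrier (suc n)} → All (_< Ω) c → Q c → HasRoot Ω c) where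

      private
        arity : ℕ → ℕ
        arity 0                   = 2
        arity 1                   = 2
        arity 2                   = 1
        arity (suc (suc (suc n))) = suc n

        -- Outside `P` and `Q` the conditions hold vacuously, which makes the relations total with
        -- default `𝟎`. Index 3 + n handles the monic polynomials of degree n + 1, which have n + 1
        -- free coefficients.
        R : ∀ i → Vec Carrier (arity i) → Carrier → Set (a ⊔ ℓ)
        R 0 (x ∷ x′ ∷ [])         y = Lift a (y ≈ x ⊕ x′)
        R 1 (x ∷ x′ ∷ [])         y = Lift a (y ≈ x ⊗ x′)
        R 2 (x ∷ [])              y = P x → ¬ x ≈ 𝟎 → x ⊗ y ≈ 𝟏
        R (suc (suc (suc n))) c   y = Q c → monic c y ≈ 𝟎

        R-resp : ∀ i {v w y} → Pointwise _≈_ v w → R i v y → R i w y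
        R-resp 0 (x≈ ∷ x′≈ ∷ []) (lift y≈) = lift (≈-trans y≈ (⊕-cong x≈ x′≈))
        R-resp 1 (x≈ ∷ x′≈ ∷ []) (lift y≈) = lift (≈-trans y≈ (⊗-cong x≈ x′≈))
        R-resp 2 (x≈ ∷ []) h Px x≉𝟎 =
          ≈-trans (⊗-congʳ (sym x≈)) (h (P-resp x≈ Px) (λ x≈𝟎 → x≉𝟎 (≈-trans (sym x≈) x≈𝟎)))
        R-resp (suc (suc (suc n))) c≋d h Qd =
          ≈-trans (monic-cong (Pointwise.sym sym c≋d) refl) (h (Q-resp c≋d Qd))

        total : ∀ i {v} → All (_< Ω) v → ∃[ y ] y < Ω × R i v y
        total 0 {x ∷ x′ ∷ []} (x<Ω ∷ x′<Ω ∷ []) = x ⊕ x′ , ⊕-<Ω x<Ω x′<Ω , lift refl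
        total 1 {x ∷ x′ ∷ []} (x<Ω ∷ x′<Ω ∷ []) = x ⊗ x′ , ⊗-<Ω x<Ω x′<Ω , lift refl
        total 2 {x ∷ []} (x<Ω ∷ []) with P? x | x ≟ 𝟎
        ... | no ¬Px | _       = 𝟎 , 𝟎<Ω , λ Px _ → contradiction Px ¬Px
        ... | yes _  | yes x≈𝟎 = 𝟎 , 𝟎<Ω , λ _ x≉𝟎 → contradiction x≈𝟎 x≉𝟎
        ... | yes Px | no x≉𝟎  = let y , y<Ω , xy≈𝟏 = inv x<Ω Px x≉𝟎 in y , y<Ω , λ _ _ → xy≈𝟏
        total (suc (suc (suc n))) {c} c<Ω with Q? c
        ... | no ¬Qc = 𝟎 , 𝟎<Ω , λ Qc → contradiction Qc ¬Qc
        ... | yes Qc = let y , y<Ω , cy≈𝟎 = root c<Ω Qc in y , y<Ω , λ _ → cy≈𝟎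

      -- `P` and `Q` single out the elements and polynomials whose inverses and roots are already
      -- available below `Ω`. Inside the inductions these come from induction hypotheses; at the end
      -- both predicates hold throughout.
      closedSubring : ∀ {β} → β < Ω →
                      ∃[ Δ ] Δ < Ω × β < Δ × IsSubring Δ ×
                        (∀ {x} → x < Δ → P x → ¬ x ≈ 𝟎 → HasInverse Δ x) ×
                        (∀ {n} {c : Vec Carrier (suc n)} → All (_< Δ) c → Q c → HasRoot Δ c)
      closedSubring {β} β<Ω =
        let s , s<Ω , f<s , _ = supremum {λ { zero → β ; (suc _) → 𝟏 }} (λ { zero → β<Ω ; (suc _) → 𝟏<Ω })
            Δ , Δ<Ω , s<Δ , closed = closingOff arity R R-resp total s<Ω
        in Δ , Δ<Ω , trans (f<s 0) s<Δ
           , record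
             { 𝟏<Δ      = trans (f<s 1) s<Δ
             ; ⊕-closed = λ x<Δ y<Δ → let z , z<Δ , lift z≈ = closed 0 (x<Δ ∷ y<Δ ∷ [])
                                      in <-respˡ-≈ z≈ z<Δ
             ; ⊗-closed = λ x<Δ y<Δ → let z , z<Δ , lift z≈ = closed 1 (x<Δ ∷ y<Δ ∷ [])
                                      in <-respˡ-≈ z≈ z<Δ }
           , (λ x<Δ Px x≉𝟎 → let y , y<Δ , h = closed 2 (x<Δ ∷ []) in y , y<Δ , h Px x≉𝟎)
           , (λ {n} c<Δ Qc → let y , y<Δ , h = closed (suc (suc (suc n))) c<Δ in y , y<Δ , h Qc)

    inverse-<Ω : ∀ {x} → x < Ω → ¬ x ≈ 𝟎 → HasInverse Ω x
    inverse-<Ω {x} = go x (<-wellFounded x)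
      where
      go : ∀ x → Acc _<_ x → x < Ω → ¬ x ≈ 𝟎 → HasInverse Ω x
      go x (acc rs) x<Ω x≉𝟎 =
        let Δ , Δ<Ω , x<Δ , isSubring , inv , _ =
              closedSubring
                -- Only inverses of elements below `x` are available yet, and no roots are
                -- requested.
                (λ y → Lift a (y < x)) (λ y → map′ lift lower (y <? x))
                (λ y≈z (lift z<x) → lift (<-respˡ-≈ (sym y≈z) z<x))
                (λ _ → Lift (a ⊔ ℓ) ⊥) (λ _ → no λ ()) (λ _ ())
                (λ y<Ω (lift y<x) y≉𝟎 → go _ (rs y<x) y<Ω y≉𝟎) (λ _ ())
                x<Ω
        in [ (λ (y , y<Δ , xy≈𝟏) → y , trans y<Δ Δ<Ω , xy≈𝟏)
           , (λ xΔ≈𝟏 → Δ , Δ<Ω , xΔ≈𝟏)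
           ]′ (SimplestExtension.inverse isSubring x≉𝟎 x<Δ
                 (λ y<x → inv (trans y<x x<Δ) (lift y<x)))

    upperBound : ∀ {n} {c : Vec Carrier n} → All (_< Ω) c → ∃[ β ] β < Ω × All (_< β) c
    upperBound []          = 𝟎 , 𝟎<Ω , []
    upperBound {c = x ∷ _} (x<Ω ∷ c<Ω) =
      let β , β<Ω , c<β = upperBound c<Ω
          s , s<Ω , f<s , _ = supremum {λ { zero → x ; (suc _) → β }}
                                       (λ { zero → x<Ω ; (suc _) → β<Ω })
      in s , s<Ω , f<s 0 ∷ All.map (λ y<β → trans y<β (f<s 1)) c<β

    root-step : ∀ {n} {c : Vec Carrier (suc n)} →
                (∀ {k} → k ℕ.< n → {d : Vec Carrier (suc k)} → All (_< Ω) d → HasRoot Ω d) →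
                (∀ {d : Vec Carrier (suc n)} → Lex-< _≈_ _<_ d c → All (_< Ω) d → HasRoot Ω d) →
                All (_< Ω) c → HasRoot Ω c
    root-step {n} {c} lower-degree earlier c<Ω =
      let β , β<Ω , c<β = upperBound c<Ω
          Δ , Δ<Ω , β<Δ , isSubring , inv , root =
            closedSubring
              (λ _ → Lift (a ⊔ ℓ) ⊤) (λ _ → yes (lift tt)) (λ _ p → p)
              -- Here `d` has degree `suc k` and `c` has degree `suc n`, so `k < n` means smaller
              -- degree.
              (λ {k} d → Lift a (k ℕ.< n) ⊎ Lex-< _≈_ _<_ d c)
              (λ {k} d → map′ lift lower (k ℕ.<? n) ⊎-dec Lex.<-decidable _≟_ _<?_ d c)
              (λ { d≋e (inj₁ k<n) → inj₁ k<n
                 ; d≋e (inj₂ e<c) → inj₂ (Lex.<-respectsˡ Eq.isPartialEquivalence <-respˡ-≈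
                                            (Pointwise.sym sym d≋e) e<c) })
              (λ y<Ω _ → inverse-<Ω y<Ω)
              (λ { d<Ω (inj₁ (lift k<n)) → lower-degree k<n d<Ω
                 ; d<Ω (inj₂ d<c)        → sameDegree d<c d<Ω })
              β<Ω
      in [ (λ (x , x<Δ , c[x]≈𝟎) → x , trans x<Δ Δ<Ω , c[x]≈𝟎)
         , (λ c[Δ]≈𝟎 → Δ , Δ<Ω , c[Δ]≈𝟎)
         ]′ (SimplestExtension.monicRoot isSubring (λ x<Δ → inv x<Δ (lift tt))
               (λ k<n d<Δ → root d<Δ (inj₁ (lift k<n)))
               (All.map (λ x<β → trans x<β β<Δ) c<β)
               (λ h<Δ h<c → root h<Δ (inj₂ h<c)))
      where
      -- `Lex-<` is typed for vectors of different lengths but forces the lengths to agree.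
      sameDegree : ∀ {k} {d : Vec Carrier (suc k)} → Lex-< _≈_ _<_ d c → All (_< Ω) d → HasRoot Ω d
      sameDegree d<c with ≡.refl ← length-equal d<c = earlier d<c

    -- Induction on the degree and, within a degree, on the lexicographic order, which is
    -- well-founded for vectors of a fixed length.
    root-<Ω : ∀ {n} {c : Vec Carrier (suc n)} → All (_< Ω) c → HasRoot Ω c
    root-<Ω {n} {c} = go n c (ℕ.<-wellFounded n) (lex-wellFounded c)
      where
      lex-wellFounded : ∀ {n} → WellFounded (Lex-< _≈_ _<_ {n} {n})
      lex-wellFounded = Lex.<-wellFounded ≈-trans <-respʳ-≈ <-wellFounded
      go : ∀ n (c : Vec Carrier (suc n)) → Acc ℕ._<_ n → Acc (Lex-< _≈_ _<_) c →
           All (_< Ω) c → HasRoot Ω c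
      go n c (acc rn) (acc rc) = root-step
        (λ k<n → go _ _ (rn k<n) (lex-wellFounded _))
        (λ d<c → go n _ (acc rn) (rc d<c))

    algebraicallyClosedSubfield : ∀ {β} → β < Ω →
      ∃[ Δ ] Δ < Ω × β < Δ × IsSubring Δ ×
        (∀ {x} → x < Δ → ¬ x ≈ 𝟎 → HasInverse Δ x) ×
        (∀ {n} {c : Vec Carrier (suc n)} → All (_< Δ) c → HasRoot Δ c)
    algebraicallyClosedSubfield β<Ω =
      let Δ , Δ<Ω , β<Δ , isSubring , inv , root =
            closedSubring
              (λ _ → Lift (a ⊔ ℓ) ⊤) (λ _ → yes (lift tt)) (λ _ p → p)
              (λ _ → Lift (a ⊔ ℓ) ⊤) (λ _ → yes (lift tt)) (λ _ p → p)
              (λ x<Ω _ → inverse-<Ω x<Ω) (λ c<Ω _ → root-<Ω c<Ω) β<Ω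
      in Δ , Δ<Ω , β<Δ , isSubring , (λ x<Δ → inv x<Δ (lift tt)) , λ c<Δ → root c<Δ (lift tt)

-- The order on ordinal trees.

open import Defs

<⇒≤ : ∀ α β → α < β → α ≤ β
<⇒≤ (lim A f) (lim B g) (b , p) a = b , <⇒≤ (f a) (g b) (p a)

<-trans : ∀ α β γ → α < β → β < γ → α < γ
<-trans α β γ p q = <-≤-trans α β γ p (<⇒≤ β γ q)

<-irrefl : ∀ α → ¬ α < α
<-irrefl α = go α (<-wellFounded α)
  where
  go : ∀ α → Acc _<_ α → ¬ α < α
  go α (acc rs) α<α = go α (rs α<α) α<α

<⇒≱ : ∀ α β → α < β → ¬ β ≤ α
<⇒≱ α β p q = <-irrefl α (<-≤-trans α β α p q)

≈-refl : ∀ α → α ≈ α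
≈-refl α = ≤-refl α , ≤-refl α

≈-trans : ∀ α β γ → α ≈ β → β ≈ γ → α ≈ γ
≈-trans α β γ (p , p′) (q , q′) = ≤-trans α β γ p q , ≤-trans γ β α q′ p′

lim-upper : ∀ {A} (f : A → Ord) a → f a < lim A f
lim-upper f a = a , ≤-refl (f a)

-- The nodes of the tree α other than its root represent all ordinals below α,
-- which therefore form a set.
Node : Ord → Set
Node (lim A f) = Σ[ a ∈ A ] (⊤ ⊎ Node (f a))

node : ∀ α → Node α → Ord
node (lim A f) (a , inj₁ _) = f a
node (lim A f) (a , inj₂ n) = node (f a) n

node-< : ∀ α n → node α n < α
node-< (lim A f) (a , inj₁ _) = lim-upper f a
node-< (lim A f) (a , inj₂ n) = a , <⇒≤ (node (f a) n) (f a) (node-< (f a) n)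

-- Trichotomy, mexes and the nim operations under excluded middle.

module Classical (em : ExcludedMiddle (lsuc 0ℓ)) where

  em₀ : {P : Set} → Dec P
  em₀ = map′ lower lift em

  <-or-≥ : ∀ α β → α < β ⊎ β ≤ α
  <-or-≥ α (lim B g) with em₀ {Σ[ b ∈ B ] α ≤ g b}
  ... | yes α<β = inj₁ α<β
  ... | no  α≮β = inj₂ λ b → below b (<-or-≥ (g b) α)
    where
    below : ∀ b → g b < α ⊎ α ≤ g b → g b < α
    below b (inj₁ gb<α) = gb<α
    below b (inj₂ α≤gb) = contradiction (b , α≤gb) α≮β

  ≮⇒≥ : ∀ α β → ¬ α < β → β ≤ α
  ≮⇒≥ α β α≮β with <-or-≥ α β
  ... | inj₁ α<β = contradiction α<β α≮β
  ... | inj₂ β≤α = β≤α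

  <-compare : ∀ α β → Tri (α < β) (α ≈ β) (β < α)
  <-compare α β with <-or-≥ α β | <-or-≥ β α
  ... | inj₁ α<β | _        = tri< α<β (λ (_ , β≤α) → <⇒≱ α β α<β β≤α)
                                       (λ β<α → <⇒≱ α β α<β (<⇒≤ β α β<α))
  ... | inj₂ β≤α | inj₁ β<α = tri> (λ α<β → <⇒≱ α β α<β β≤α) (λ (α≤β , _) → <⇒≱ β α β<α α≤β) β<α
  ... | inj₂ β≤α | inj₂ α≤β = tri≈ (λ α<β → <⇒≱ α β α<β β≤α) (α≤β , β≤α) (λ β<α → <⇒≱ β α β<α α≤β)

  Ord-strictTotalOrder : StrictTotalOrder (lsuc 0ℓ) 0ℓ 0ℓ
  Ord-strictTotalOrder = record
    { Carrier = Ord ; _≈_ = _≈_ ; _<_ = _<_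
    ; isStrictTotalOrder = record
      { isStrictPartialOrder = record
        { isEquivalence = record
          { refl  = λ {α} → ≈-refl α
          ; sym   = swap
          ; trans = λ {α} {β} {γ} → ≈-trans α β γ }
        ; irrefl   = λ {α} {β} (_ , β≤α) α<β → <⇒≱ α β α<β β≤α
        ; trans    = λ {α} {β} {γ} → <-trans α β γ
        ; <-resp-≈ = (λ {α} {β} {γ} (β≤γ , _) α<β → <-≤-trans α β γ α<β β≤γ)
                   , (λ {α} {β} {γ} (_ , γ≤β) β<α → ≤-<-trans γ β α γ≤β β<α) }
      ; compare = <-compare } }

  node-surjective : ∀ α β → β < α → Σ[ n ∈ Node α ] β ≈ node α n
  node-surjective (lim A f) β (a , β≤fa) with <-or-≥ β (f a)
  ... | inj₂ fa≤β = (a , inj₁ tt) , β≤fa , fa≤β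
  ... | inj₁ β<fa = let n , β≈ = node-surjective (f a) β β<fa in (a , inj₂ n) , β≈

  <-least : ∀ {ℓ} (P : Ord → Set ℓ) → (∀ β → Dec (∃[ δ ] δ < β × P δ)) →
            ∀ {β} → P β → ∃[ γ ] P γ × ∀ δ → P δ → γ ≤ δ
  <-least P dec {β} = go β (<-wellFounded β)
    where
    go : ∀ β → Acc _<_ β → P β → ∃[ γ ] P γ × ∀ δ → P δ → γ ≤ δ
    go β (acc rs) Pβ with dec β
    ... | yes (δ , δ<β , Pδ) = go δ (rs δ<β) Pδ
    ... | no none            = β , Pβ , λ δ Pδ → ≮⇒≥ δ β (λ δ<β → none (δ , δ<β , Pδ))

  module _ {S : Ord → Set₁} where

    mex-unique : ∀ γ γ′ → IsMex S γ → IsMex S γ′ → γ ≈ γ′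
    mex-unique γ γ′ (γ∉S , γ≤) (γ′∉S , γ′≤) = γ≤ γ′ γ′∉S , γ′≤ γ γ∉S

    -- `lim I f` exceeds every `f i` and so lies outside `S`; hence the complement of `S` is
    -- nonempty and has a least element.
    mex-isMex : ∀ {I : Set} (f : I → Ord) → (∀ δ → S δ → Σ[ i ∈ I ] δ ≈ f i) → IsMex S (mex em S)
    mex-isMex {I} f S⊆f with em {∃[ γ ] IsMex S γ}
    ... | yes (_ , isMex) = isMex
    ... | no none         = contradiction
      (<-least (λ δ → ¬ S δ) (λ _ → em) {lim I f} λ Slim →
        let i , lim≤fi , _ = S⊆f (lim I f) Slim
        in <⇒≱ (f i) (lim I f) (lim-upper f i) lim≤fi)
      none

    IsMex-< : ∀ γ → IsMex S γ → ∀ δ → δ < γ → S δ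
    IsMex-< γ (_ , γ≤) δ δ<γ with em {S δ}
    ... | yes Sδ = Sδ
    ... | no ¬Sδ = contradiction (γ≤ δ ¬Sδ) (<⇒≱ δ γ δ<γ)

  IsMex-resp : ∀ {S S′ : Ord → Set₁} → (∀ δ → S δ → S′ δ) → (∀ δ → S′ δ → S δ) →
               ∀ γ → IsMex S γ → IsMex S′ γ
  IsMex-resp to from γ (γ∉S , γ≤) = (λ S′γ → γ∉S (from γ S′γ)) , λ δ δ∉S′ → γ≤ δ (λ Sδ → δ∉S′ (to δ Sδ))

  mex-cong : ∀ {S S′ : Ord → Set₁} → (∀ δ → S δ → S′ δ) → (∀ δ → S′ δ → S δ) → mex em S ≈ mex em S′
  mex-cong {S} {S′} to from with em {∃[ γ ] IsMex S γ} | em {∃[ γ ] IsMex S′ γ}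
  ... | yes (γ , isMex) | yes (γ′ , isMex′) = mex-unique {S′} γ γ′ (IsMex-resp to from γ isMex) isMex′
  ... | yes (γ , isMex) | no none           = contradiction (γ , IsMex-resp to from γ isMex) none
  ... | no none         | yes (γ , isMex)   = contradiction (γ , IsMex-resp from to γ isMex) none
  ... | no _            | no _              = ≈-refl 𝟎

  infixl 6 _+_
  infixl 7 _*_
  _+_ _*_ : Ord → Ord → Ord
  _+_ = _⊕_ em
  _*_ = _⊗_ em

  SumOption : Ord → Ord → Ord → Set₁
  SumOption α β δ = (Σ[ α′ ∈ Ord ] α′ < α × δ ≈ α′ + β) ⊎ (Σ[ β′ ∈ Ord ] β′ < β × δ ≈ α + β′)

  -- The accessibility proofs vary as well, because the recursion passes on `rα p` and not the
  -- canonical proof. Congruence and independence of these proofs are thus shown at once.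
  nimSum-cong : ∀ α β α₁ β₁ (a : Acc _<_ α) (b : Acc _<_ β) (a₁ : Acc _<_ α₁) (b₁ : Acc _<_ β₁) →
                α ≈ α₁ → β ≈ β₁ → nimSum em α β a b ≈ nimSum em α₁ β₁ a₁ b₁
  nimSum-cong α β α₁ β₁ (acc ra) (acc rb) (acc ra₁) (acc rb₁) α≈@(α≤α₁ , α₁≤α) β≈@(β≤β₁ , β₁≤β) = mex-cong
    (λ { δ (inj₁ (α′ , p , δ≈)) →
         let p₁ = <-≤-trans α′ α α₁ p α≤α₁ in
         inj₁ (α′ , p₁ , ≈-trans δ _ _ δ≈
           (nimSum-cong α′ β α′ β₁ (ra p) (acc rb) (ra₁ p₁) (acc rb₁) (≈-refl α′) β≈))
       ; δ (inj₂ (β′ , q , δ≈)) →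
         let q₁ = <-≤-trans β′ β β₁ q β≤β₁ in
         inj₂ (β′ , q₁ , ≈-trans δ _ _ δ≈
           (nimSum-cong α β′ α₁ β′ (acc ra) (rb q) (acc ra₁) (rb₁ q₁) α≈ (≈-refl β′))) })
    (λ { δ (inj₁ (α′ , p₁ , δ≈)) →
         let p = <-≤-trans α′ α₁ α p₁ α₁≤α in
         inj₁ (α′ , p , ≈-trans δ _ _ δ≈
           (swap (nimSum-cong α′ β α′ β₁ (ra p) (acc rb) (ra₁ p₁) (acc rb₁) (≈-refl α′) β≈)))
       ; δ (inj₂ (β′ , q₁ , δ≈)) →
         let q = <-≤-trans β′ β₁ β q₁ β₁≤β in
         inj₂ (β′ , q , ≈-trans δ _ _ δ≈
           (swap (nimSum-cong α β′ α₁ β′ (acc ra) (rb q) (acc ra₁) (rb₁ q₁) α≈ (≈-refl β′)))) })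

  +-cong : ∀ α β α₁ β₁ → α ≈ α₁ → β ≈ β₁ → α + β ≈ α₁ + β₁
  +-cong α β α₁ β₁ = nimSum-cong α β α₁ β₁ (<-wellFounded α) (<-wellFounded β) (<-wellFounded α₁) (<-wellFounded β₁)

  nimSum≈+ : ∀ α β a b → nimSum em α β a b ≈ α + β
  nimSum≈+ α β a b =
    nimSum-cong α β α β a b (<-wellFounded α) (<-wellFounded β) (≈-refl α) (≈-refl β)

  -- The nodes of the two trees index all options up to `_≈_`, so the options form the image of a
  -- set and their mex exists.
  nimSum-isMex : ∀ α β a b → IsMex (SumOption α β) (nimSum em α β a b)
  nimSum-isMex α β (acc ra) (acc rb) = IsMex-resp
    (λ { δ (inj₁ (α′ , p , δ≈)) → inj₁ (α′ , p , ≈-trans δ _ _ δ≈ (left α′ p))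
       ; δ (inj₂ (β′ , q , δ≈)) → inj₂ (β′ , q , ≈-trans δ _ _ δ≈ (right β′ q)) })
    (λ { δ (inj₁ (α′ , p , δ≈)) → inj₁ (α′ , p , ≈-trans δ _ _ δ≈ (swap (left α′ p)))
       ; δ (inj₂ (β′ , q , δ≈)) → inj₂ (β′ , q , ≈-trans δ _ _ δ≈ (swap (right β′ q))) })
    _
    (mex-isMex [ (λ n → node α n + β) , (λ n → α + node β n) ]′
      λ { δ (inj₁ (α′ , p , δ≈)) → let n , α′≈ = node-surjective α α′ p in
            inj₁ n , ≈-trans δ _ _ δ≈ (≈-trans _ _ _ (left α′ p)
              (+-cong α′ β (node α n) β α′≈ (≈-refl β)))
        ; δ (inj₂ (β′ , q , δ≈)) → let n , β′≈ = node-surjective β β′ q in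
            inj₂ n , ≈-trans δ _ _ δ≈ (≈-trans _ _ _ (right β′ q)
              (+-cong α β′ α (node β n) (≈-refl α) β′≈)) })
    where
    left : ∀ α′ p → nimSum em α′ β (ra p) (acc rb) ≈ α′ + β
    left α′ p = nimSum≈+ α′ β (ra p) (acc rb)
    right : ∀ β′ q → nimSum em α β′ (acc ra) (rb q) ≈ α + β′
    right β′ q = nimSum≈+ α β′ (acc ra) (rb q)

  +-isMex : ∀ α β → IsMex (SumOption α β) (α + β)
  +-isMex α β = nimSum-isMex α β (<-wellFounded α) (<-wellFounded β)

  ProductOption : Ord → Ord → Ord → Set₁
  ProductOption α β δ = Σ[ α′ ∈ Ord ] α′ < α × (Σ[ β′ ∈ Ord ] β′ < β × δ ≈ α′ * β + α * β′ + α′ * β′)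

  +₃-cong : ∀ α β γ α₁ β₁ γ₁ → α ≈ α₁ → β ≈ β₁ → γ ≈ γ₁ → α + β + γ ≈ α₁ + β₁ + γ₁
  +₃-cong α β γ α₁ β₁ γ₁ α≈ β≈ γ≈ = +-cong (α + β) γ (α₁ + β₁) γ₁ (+-cong α β α₁ β₁ α≈ β≈) γ≈

  nimProduct-cong : ∀ α β α₁ β₁ (a : Acc _<_ α) (b : Acc _<_ β) (a₁ : Acc _<_ α₁) (b₁ : Acc _<_ β₁) →
                    α ≈ α₁ → β ≈ β₁ → nimProduct em α β a b ≈ nimProduct em α₁ β₁ a₁ b₁
  nimProduct-cong α β α₁ β₁ (acc ra) (acc rb) (acc ra₁) (acc rb₁) α≈@(α≤α₁ , α₁≤α) β≈@(β≤β₁ , β₁≤β) = mex-cong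
    (λ { δ (α′ , p , β′ , q , δ≈) →
         let p₁ = <-≤-trans α′ α α₁ p α≤α₁
             q₁ = <-≤-trans β′ β β₁ q β≤β₁
         in α′ , p₁ , β′ , q₁ , ≈-trans δ _ _ δ≈ (option α′ p p₁ β′ q q₁) })
    (λ { δ (α′ , p₁ , β′ , q₁ , δ≈) →
         let p = <-≤-trans α′ α₁ α p₁ α₁≤α
             q = <-≤-trans β′ β₁ β q₁ β₁≤β
         in α′ , p , β′ , q , ≈-trans δ _ _ δ≈ (swap (option α′ p p₁ β′ q q₁)) })
    where
    option : ∀ α′ p p₁ β′ q q₁ →
      nimProduct em α′ β (ra p) (acc rb) + nimProduct em α β′ (acc ra) (rb q) +
        nimProduct em α′ β′ (ra p) (rb q) ≈
      nimProduct em α′ β₁ (ra₁ p₁) (acc rb₁) + nimProduct em α₁ β′ (acc ra₁) (rb₁ q₁) +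
        nimProduct em α′ β′ (ra₁ p₁) (rb₁ q₁)
    option α′ p p₁ β′ q q₁ = +₃-cong _ _ _ _ _ _
      (nimProduct-cong α′ β α′ β₁ (ra p) (acc rb) (ra₁ p₁) (acc rb₁) (≈-refl α′) β≈)
      (nimProduct-cong α β′ α₁ β′ (acc ra) (rb q) (acc ra₁) (rb₁ q₁) α≈ (≈-refl β′))
      (nimProduct-cong α′ β′ α′ β′ (ra p) (rb q) (ra₁ p₁) (rb₁ q₁) (≈-refl α′) (≈-refl β′))

  *-cong : ∀ α β α₁ β₁ → α ≈ α₁ → β ≈ β₁ → α * β ≈ α₁ * β₁
  *-cong α β α₁ β₁ = nimProduct-cong α β α₁ β₁ (<-wellFounded α) (<-wellFounded β) (<-wellFounded α₁) (<-wellFounded β₁)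

  nimProduct≈* : ∀ α β a b → nimProduct em α β a b ≈ α * β
  nimProduct≈* α β a b =
    nimProduct-cong α β α β a b (<-wellFounded α) (<-wellFounded β) (≈-refl α) (≈-refl β)

  nimProduct-isMex : ∀ α β a b → IsMex (ProductOption α β) (nimProduct em α β a b)
  nimProduct-isMex α β (acc ra) (acc rb) = IsMex-resp
    (λ { δ (α′ , p , β′ , q , δ≈) → α′ , p , β′ , q , ≈-trans δ _ _ δ≈ (option α′ p β′ q) })
    (λ { δ (α′ , p , β′ , q , δ≈) → α′ , p , β′ , q , ≈-trans δ _ _ δ≈ (swap (option α′ p β′ q)) })
    _
    (mex-isMex {I = Node α × Node β} (λ (m , n) → node α m * β + α * node β n + node α m * node β n)
      λ { δ (α′ , p , β′ , q , δ≈) →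
          let m , α′≈ = node-surjective α α′ p
              n , β′≈ = node-surjective β β′ q
          in (m , n) , ≈-trans δ _ _ δ≈ (≈-trans _ _ _ (option α′ p β′ q) (+₃-cong _ _ _ _ _ _
               (*-cong α′ β (node α m) β α′≈ (≈-refl β))
               (*-cong α β′ α (node β n) (≈-refl α) β′≈)
               (*-cong α′ β′ (node α m) (node β n) α′≈ β′≈))) })
    where
    option : ∀ α′ p β′ q →
      nimProduct em α′ β (ra p) (acc rb) + nimProduct em α β′ (acc ra) (rb q) +
        nimProduct em α′ β′ (ra p) (rb q) ≈
      α′ * β + α * β′ + α′ * β′
    option α′ p β′ q = +₃-cong _ _ _ _ _ _
      (nimProduct≈* α′ β (ra p) (acc rb))
      (nimProduct≈* α β′ (acc ra) (rb q))
      (nimProduct≈* α′ β′ (ra p) (rb q))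

  *-isMex : ∀ α β → IsMex (ProductOption α β) (α * β)
  *-isMex α β = nimProduct-isMex α β (<-wellFounded α) (<-wellFounded β)

  nimArithmetic : NimArithmetic (lsuc 0ℓ) 0ℓ
  nimArithmetic = record
    { strictTotalOrder = Ord-strictTotalOrder
    ; <-wellFounded    = <-wellFounded
    ; 𝟎 = 𝟎 ; 𝟏 = 𝟏 ; _⊕_ = _+_ ; _⊗_ = _*_
    ; x≮𝟎         = λ ()
    ; 𝟎<𝟏         = tt , λ ()
    ; x<𝟏⇒x≈𝟎     = λ (_ , x≤𝟎) → x≤𝟎 , λ ()
    ; ⊕-cong      = λ {α} {α₁} {β} {β₁} → +-cong α β α₁ β₁
    ; ⊗-cong      = λ {α} {α₁} {β} {β₁} → *-cong α β α₁ β₁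
    ; ⊕-excludesˡ = λ {α} {β} {α′} p eq → proj₁ (+-isMex α β) (inj₁ (α′ , p , swap eq))
    ; ⊕-excludesʳ = λ {α} {β} {β′} q eq → proj₁ (+-isMex α β) (inj₂ (β′ , q , swap eq))
    ; <-⊕         = λ {α} {β} {γ} → IsMex-< (α + β) (+-isMex α β) γ
    ; ⊗-excludes  = λ {α} {β} {α′} {β′} p q eq → proj₁ (*-isMex α β) (α′ , p , β′ , q , swap eq)
    ; <-⊗         = λ {α} {β} {γ} → IsMex-< (α * β) (*-isMex α β) γ
    }

-- Countable ordinals.

unpair : ℕ → ℕ × ℕ
unpair zero    = 0 , 0
unpair (suc k) with unpair k
... | zero  , n = suc n , 0
... | suc m , n = m , suc n

-- `unpair` walks along the antidiagonals in turn. Traced backwards, the second component decreases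
-- along an antidiagonal, and at its end the sum `s` drops.
unpair-surjective : ∀ m n → ∃[ k ] unpair k ≡ (m , n)
unpair-surjective m n = go (m ℕ.+ n) m n ≡.refl
  where
  go : ∀ s m n → m ℕ.+ n ≡ s → ∃[ k ] unpair k ≡ (m , n)
  go _       zero    zero    _  = 0 , ≡.refl
  go (suc s) (suc m) zero    eq = let k , eqₖ = go s 0 m (≡.trans (≡.sym (ℕ.+-identityʳ m)) (ℕ.suc-injective eq))
                                  in suc k , step k eqₖ
    where
    step : ∀ k → unpair k ≡ (0 , m) → unpair (suc k) ≡ (suc m , 0)
    step k eq rewrite eq = ≡.refl
  go s       m       (suc n) eq = let k , eqₖ = go s (suc m) n (≡.trans (≡.sym (ℕ.+-suc m n)) eq)
                                  in suc k , step k eqₖ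
    where
    step : ∀ k → unpair k ≡ (suc m , n) → unpair (suc k) ≡ (m , suc n)
    step k eq rewrite eq = ≡.refl

ℕ-least : ∀ {P : ℕ → Set} → (∀ n → Dec (P n)) → ∃[ n ] P n → ∃[ n ] P n × ∀ {m} → P m → n ℕ.≤ m
ℕ-least {P} P? (n , Pn) = go n (ℕ.<-wellFounded n) Pn
  where
  go : ∀ n → Acc ℕ._<_ n → P n → ∃[ n ] P n × ∀ {m} → P m → n ℕ.≤ m
  go n (acc rs) Pn with ℕ.anyUpTo? P? n
  ... | yes (m , m<n , Pm) = go m (rs m<n) Pm
  ... | no none            = n , Pn , λ Pm → ℕ.≮⇒≥ (λ m<n → none (_ , m<n , Pm))

-- Values of `g` outside `α` are allowed, so that `𝟎` is enumerable too.
Enumerable : Ord → Set₁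
Enumerable α = Σ[ g ∈ (ℕ → Ord) ] (∀ β → β < α → Σ[ n ∈ ℕ ] β ≈ g n)

module OrderType (em : ExcludedMiddle (lsuc 0ℓ)) where
  open Classical em

  countable⇒enumerable : ∀ {α} → Countable α → Enumerable α
  countable⇒enumerable {α} inj = (λ n → value n em) , λ β β<α → Injection.to inj (β , β<α) , at β β<α em
    where
    Preimage : ℕ → Set₁
    Preimage n = Σ[ x ∈ Σ Ord (_< α) ] Injection.to inj x ≡ n
    value : ∀ n → Dec (Preimage n) → Ord
    value n (yes ((β , _) , _)) = β
    value n (no _)              = 𝟎
    at : ∀ β β<α (d : Dec (Preimage (Injection.to inj (β , β<α)))) → β ≈ value _ d
    at β β<α (yes (_ , eq)) = swap (Injection.injective inj eq)
    at β β<α (no none)      = contradiction (_ , ≡.refl) none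

  -- Taking the least index makes the map into ℕ respect `_≈_`, whatever proof of `β < α` is given
  -- and however often `g` repeats a value.
  enumerable⇒countable : ∀ {α} → Enumerable α → Countable α
  enumerable⇒countable {α} (g , surj) = record
    { to        = λ (β , β<α) → proj₁ (index β β<α)
    ; cong      = λ { {β , β<α} {γ , γ<α} β≈γ → ℕ.≤-antisym
        (proj₂ (proj₂ (index β β<α)) (≈-trans β γ _ β≈γ (proj₁ (proj₂ (index γ γ<α)))))
        (proj₂ (proj₂ (index γ γ<α)) (≈-trans γ β _ (swap β≈γ) (proj₁ (proj₂ (index β β<α))))) }
    ; injective = λ { {β , β<α} {γ , γ<α} eq → ≈-trans β _ γ (proj₁ (proj₂ (index β β<α)))
        (≡.subst (λ n → g n ≈ γ) (≡.sym eq) (swap (proj₁ (proj₂ (index γ γ<α))))) }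
    }
    where
    index : ∀ β → β < α → ∃[ n ] β ≈ g n × ∀ {m} → β ≈ g m → n ℕ.≤ m
    index β β<α = ℕ-least (λ _ → em₀) (surj β β<α)

  ≤⇒≈⊎< : ∀ α β → α ≤ β → α ≈ β ⊎ α < β
  ≤⇒≈⊎< α β α≤β = [ inj₂ , (λ β≤α → inj₁ (α≤β , β≤α)) ]′ (<-or-≥ α β)

  lim-enumerable : ∀ (f : ℕ → Ord) → (∀ n → Enumerable (f n)) → Enumerable (lim ℕ f)
  lim-enumerable f enum = (λ k → g (unpair k)) , λ { β (n , β≤fn) →
      let m , β≈ = at n β (≤⇒≈⊎< β (f n) β≤fn)
          k , eq = unpair-surjective n m
      in k , ≡.subst (λ p → β ≈ g p) (≡.sym eq) β≈ }
    where
    g : ℕ × ℕ → Ord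
    -- Position 0 of row `n` is reserved for `f n` itself, which the enumeration of the ordinals
    -- below it need not contain.
    g (n , zero)  = f n
    g (n , suc m) = proj₁ (enum n) m
    at : ∀ n β → β ≈ f n ⊎ β < f n → ∃[ m ] β ≈ g (n , m)
    at n β (inj₁ β≈fn) = 0 , β≈fn
    at n β (inj₂ β<fn) = let m , β≈ = proj₂ (enum n) β β<fn in suc m , β≈

  -- Regularity of ω₁ and unboundedness of the transcendental ordinals.

  module FirstUncountable {ω₁ : Ord} (isFirst : IsFirstUncountable ω₁) where

    enumerable⇒<ω₁ : ∀ α → Enumerable α → α < ω₁
    enumerable⇒<ω₁ α (g , surj) with <-or-≥ α ω₁
    ... | inj₁ α<ω₁ = α<ω₁
    ... | inj₂ ω₁≤α = contradiction
      (enumerable⇒countable (g , λ β β<ω₁ → surj β (<-≤-trans β ω₁ α β<ω₁ ω₁≤α)))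
      (proj₁ isFirst)

    <ω₁⇒enumerable : ∀ α → α < ω₁ → Enumerable α
    <ω₁⇒enumerable α α<ω₁ with em {Countable α}
    ... | yes countable  = countable⇒enumerable countable
    ... | no uncountable = contradiction (proj₂ isFirst α uncountable) (<⇒≱ α ω₁ α<ω₁)

    open NimPolynomial nimArithmetic using (module IsSubring; module SimplestExtension)
    open Closure nimArithmetic

    ω₁-isRegular : IsRegular ω₁
    ω₁-isRegular = record
      { 𝟏<Ω       = enumerable⇒<ω₁ 𝟏 ((λ _ → 𝟎) , λ β (_ , β≤𝟎) → 0 , β≤𝟎 , λ ())
      ; enumerate = λ {γ} γ<ω₁ → let g , surj = <ω₁⇒enumerable γ γ<ω₁
                                 in g , λ {β} β<γ → surj β β<γ
      ; supremum  = λ {f} f<ω₁ → lim ℕ f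
          , enumerable⇒<ω₁ (lim ℕ f) (lim-enumerable f (λ n → <ω₁⇒enumerable (f n) (f<ω₁ n)))
          , lim-upper f
          , λ {y} (n , y≤fn) → n , λ fn<y → <⇒≱ (f n) y fn<y y≤fn
      }

    open Regular ω₁-isRegular public

    transcendental-unbounded : ∀ β → β < ω₁ → ∃[ Δ ] Δ < ω₁ × β < Δ × IsTranscendental em Δ
    transcendental-unbounded β β<ω₁ =
      let Δ , Δ<ω₁ , β<Δ , isSubring , inv , root = algebraicallyClosedSubfield β<ω₁
          open IsSubring isSubring
          open SimplestExtension isSubring
      in Δ , Δ<ω₁ , β<Δ
         , record
           { 0-closed   = 𝟎<Δ
           ; 1-closed   = 𝟏<Δ
           ; ⊕-closed   = λ x y → ⊕-closed
           ; ⊗-closed   = λ x y → ⊗-closed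
           ; neg-closed = λ x x<Δ → x , x<Δ , NimRing.⊕-self nimArithmetic x
           ; inv-closed = λ x → inv }
         , monicRoot⇒root inv root

  -- Ranks in a class of ordinals and the order type of an unbounded class.

  module _ (T : Ord → Set₁) where

    Ranked : ∀ α → (∀ {β} → β < α → Ord) → Ord → Set₁
    Ranked α r δ = Σ[ β ∈ Ord ] Σ[ β<α ∈ β < α ] T β × δ ≈ r β<α

    -- The transitive collapse of `T`: the value is the order type of `T` below `α`, whether or not
    -- `α` belongs to `T`.
    rank′ : ∀ α → Acc _<_ α → Ord
    rank′ α (acc rs) = mex em (Ranked α (λ β<α → rank′ _ (rs β<α)))

    rank : Ord → Ord
    rank α = rank′ α (<-wellFounded α)

    rank′-cong : ∀ α α₁ a a₁ → α ≈ α₁ → rank′ α a ≈ rank′ α₁ a₁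
    rank′-cong α α₁ (acc rs) (acc rs₁) (α≤α₁ , α₁≤α) = mex-cong
      (λ { δ (β , p , Tβ , δ≈) → let p₁ = <-≤-trans β α α₁ p α≤α₁ in
           β , p₁ , Tβ , ≈-trans δ _ _ δ≈ (rank′-cong β β (rs p) (rs₁ p₁) (≈-refl β)) })
      (λ { δ (β , p₁ , Tβ , δ≈) → let p = <-≤-trans β α₁ α p₁ α₁≤α in
           β , p , Tβ , ≈-trans δ _ _ δ≈ (rank′-cong β β (rs₁ p₁) (rs p) (≈-refl β)) })

    rank-cong : ∀ α β → α ≈ β → rank α ≈ rank β
    rank-cong α β = rank′-cong α β (<-wellFounded α) (<-wellFounded β)

    rank-isMex : ∀ α → IsMex (Ranked α (λ {β} _ → rank β)) (rank α)
    rank-isMex α = go α (<-wellFounded α)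
      where
      go : ∀ α (a : Acc _<_ α) → IsMex (Ranked α (λ {β} _ → rank β)) (rank′ α a)
      go α (acc rs) = IsMex-resp
        (λ { δ (β , p , Tβ , δ≈) → β , p , Tβ , ≈-trans δ _ _ δ≈ (canonical β p) })
        (λ { δ (β , p , Tβ , δ≈) → β , p , Tβ , ≈-trans δ _ _ δ≈ (swap (canonical β p)) })
        _
        (mex-isMex (λ n → rank (node α n)) λ { δ (β , p , Tβ , δ≈) →
          let n , β≈ = node-surjective α β p
          in n , ≈-trans δ _ _ δ≈ (≈-trans _ _ _ (canonical β p) (rank-cong β (node α n) β≈)) })
        where
        canonical : ∀ β (p : β < α) → rank′ β (rs p) ≈ rank β
        canonical β p = rank′-cong β β (rs p) (<-wellFounded β) (≈-refl β)

    -- The ranks of members of `T` form an initial segment, so a single omitted rank bounds all of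
    -- them.
    <-rank : ∀ α δ → δ < rank α → ∃[ β ] β < α × T β × δ ≈ rank β
    <-rank α = IsMex-< (rank α) (rank-isMex α)

    rank-≉ : ∀ α β → β < α → T β → ¬ rank β ≈ rank α
    rank-≉ α β β<α Tβ eq = proj₁ (rank-isMex α) (β , β<α , Tβ , swap eq)

    -- If `rank β` were smaller, it would be the rank of a member of `T` below `α`, hence below `β`,
    -- and such ranks are excluded as values of `rank β`.
    rank-mono-≤ : ∀ α β → α ≤ β → rank α ≤ rank β
    rank-mono-≤ α β α≤β = ≮⇒≥ (rank β) (rank α) λ rβ<rα →
      let γ , γ<α , Tγ , eq = <-rank α (rank β) rβ<rα
      in rank-≉ β γ (<-≤-trans γ α β γ<α α≤β) Tγ (swap eq)

    rank-mono-< : ∀ α β → α < β → T α → rank α < rank β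
    rank-mono-< α β α<β Tα with ≤⇒≈⊎< (rank α) (rank β) (rank-mono-≤ α β (<⇒≤ α β α<β))
    ... | inj₁ eq = contradiction eq (rank-≉ β α α<β Tα)
    ... | inj₂ lt = lt

    -- If `α` were below its rank, it would be the rank of some `β < α`, against the induction
    -- hypothesis. This keeps the ranks of ordinals below ω₁ below ω₁.
    rank-≤ : ∀ α → rank α ≤ α
    rank-≤ α = go α (<-wellFounded α)
      where
      go : ∀ α → Acc _<_ α → rank α ≤ α
      go α (acc rs) = ≮⇒≥ α (rank α) λ α<rα →
        let β , β<α , _ , α≤rβ , _ = <-rank α α α<rα
        in <⇒≱ β α β<α (≤-trans α (rank β) β α≤rβ (go β (rs β<α)))

    rank-injective : ∀ α β → T α → T β → rank α ≈ rank β → α ≈ β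
    rank-injective α β Tα Tβ eq with <-compare α β
    ... | tri< α<β _ _ = contradiction eq (rank-≉ β α α<β Tα)
    ... | tri≈ _ α≈β _ = α≈β
    ... | tri> _ _ β<α = contradiction (swap eq) (rank-≉ α β β<α Tβ)

    rank-cancel-< : ∀ α β → rank α < rank β → α < β
    rank-cancel-< α β rα<rβ with <-or-≥ α β
    ... | inj₁ α<β = α<β
    ... | inj₂ β≤α = contradiction (rank-mono-≤ β α β≤α) (<⇒≱ (rank α) (rank β) rα<rβ)

    module _ {ω₁ : Ord} (isFirst : IsFirstUncountable ω₁)
             (unbounded : ∀ β → β < ω₁ → ∃[ α ] α < ω₁ × β < α × T α) where
      open FirstUncountable isFirst

      -- Otherwise rank would be an injection of T ∩ ω₁ into γ, making T ∩ ω₁ bounded.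
      rank-surjective : ∀ γ → γ < ω₁ → ∃[ α ] α < ω₁ × T α × rank α ≈ γ
      rank-surjective γ γ<ω₁ with em {∃[ α ] α < ω₁ × T α × rank α ≈ γ}
      ... | yes found = found
      ... | no none   =
        let s , s<ω₁ , hs = bound {R = Bounds} Bounds-respˡ γ<ω₁ (λ {δ} _ → total δ)
            α , α<ω₁ , s<α , Tα = unbounded s s<ω₁
            y , y<s , α<y = hs (rank-<γ α α<ω₁ Tα)
        in contradiction (<-trans α y s (α<y α α<ω₁ Tα (≈-refl (rank α))) y<s)
             (λ α<s → <-irrefl α (<-trans α s α α<s s<α))
        where
        rank-<γ : ∀ α → α < ω₁ → T α → rank α < γ
        rank-<γ α α<ω₁ Tα with <-compare (rank α) γ
        ... | tri< rα<γ _ _ = rα<γ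
        ... | tri≈ _ rα≈γ _ = contradiction (α , α<ω₁ , Tα , rα≈γ) none
        ... | tri> _ _ γ<rα =
          let β , β<α , Tβ , γ≈ = <-rank α γ γ<rα
          in contradiction (β , <-trans β α ω₁ β<α α<ω₁ , Tβ , swap γ≈) none

        Bounds : Ord → Ord → Set₁
        Bounds δ y = ∀ α → α < ω₁ → T α → rank α ≈ δ → α < y

        Bounds-respˡ : ∀ {δ δ′ y} → δ ≈ δ′ → Bounds δ y → Bounds δ′ y
        Bounds-respˡ δ≈δ′ h α α<ω₁ Tα eq = h α α<ω₁ Tα (≈-trans (rank α) _ _ eq (swap δ≈δ′))

        total : ∀ δ → ∃[ y ] y < ω₁ × Bounds δ y
        total δ with em {∃[ α ] α < ω₁ × T α × rank α ≈ δ}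
        ... | no none′ = 𝟎 , 𝟎<Ω , λ α α<ω₁ Tα eq → contradiction (α , α<ω₁ , Tα , eq) none′
        ... | yes (β , β<ω₁ , Tβ , rβ≈δ) =
          let y , y<ω₁ , β<y , _ = unbounded β β<ω₁
          in y , y<ω₁ , λ α α<ω₁ Tα rα≈δ →
               let α≈β = rank-injective α β Tα Tβ (≈-trans (rank α) δ (rank β) rα≈δ (swap rβ≈δ))
               in ≤-<-trans α β y (proj₁ α≈β) β<y

      unbounded⇒hasOrderType : HasOrderType (λ α → α < ω₁ × T α) ω₁
      unbounded⇒hasOrderType =
          (λ (α , α<ω₁ , _) → rank α , ≤-<-trans (rank α) α ω₁ (rank-≤ α) α<ω₁)
        , record
          { isOrderMonomorphism = record
            { isOrderHomomorphism = record
              { cong = λ {(α , _)} {(β , _)} → rank-cong α β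
              ; mono = λ {(α , _ , Tα)} {(β , _)} α<β → rank-mono-< α β α<β Tα }
            ; injective = λ {(α , _ , Tα)} {(β , _ , Tβ)} → rank-injective α β Tα Tβ
            ; cancel    = λ {(α , _)} {(β , _)} → rank-cancel-< α β }
          ; surjective = λ (γ , γ<ω₁) →
              let α , α<ω₁ , Tα , rα≈γ = rank-surjective γ γ<ω₁
              in (α , α<ω₁ , Tα) , λ {(β , _)} β≈α →
                   ≈-trans (rank β) (rank α) γ (rank-cong β α β≈α) rα≈γ }

proposition3p7 : (em : ExcludedMiddle (lsuc 0ℓ)) (ω₁ : Ord) → IsFirstUncountable ω₁ →
    HasOrderType (λ α → α < ω₁ × IsTranscendental em α) ω₁
proposition3p7 em ω₁ isFirst =
  OrderType.unbounded⇒hasOrderType em (IsTranscendental em) isFirst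
    (OrderType.FirstUncountable.transcendental-unbounded em isFirst)
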